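{- There is a primitive recursive function $k_1:\omega\to\omega$ such that for all $e,m\in\omega$ and all $X\in{}^{\omega}\omega$, $$\langle e\rangle^X(m)\;\simeq\;\{k_1(e)\}^{\mathsf{E}}(m,X).$$ Here $\simeq$ means that either both sides converge and have the same value in $\omega$, or neither side converges.
   Context: Finite sequences of integers are coded by integers in a fixed recursive way, so single integer inputs may stand for tuples. **The functional $\mathsf{E}={}^2\mathsf{E}$.** $\mathsf{E}:{}^{\omega}\omega\to\{0,1\}$ is defined by $\mathsf{E}(y)=0$ if $\exists n\; y(n)=0$, and $\mathsf{E}(y)=1$ if $\forall n\; y(n)\neq 0$. **Kleene recursion in $\mathsf{E}$ (Turing machine model).** Programs are ordinary oracle Turing machine programs (with oracle $X$), indexed by $e\in\omega$ in a standard way, with an additional instruction allowing the machine at any stage to issue a query $Q(e',m',X)$, with $e',m'$ integers computed by the machine and the oracle $X$ held fixed. The query asks for the $\omega$-sequence of computations of program $e'$ on inputs $(m',k)$, $k=0,1,2,\dots$, with oracle $X$; if all of them converge, with values $y(k)$, then the integer $\mathsf{E}(y)$, $y=\lambda k.y(k)$, is returned to the calling computation in one step. Formally, for a set $C$ of pairs let $\Gamma(C)$ be the set of pairs $\langle\langle e,m,X\rangle,n\rangle$ such that program $e$ run on input $m$ with oracle $X$ halts with output $n$, where it makes only queries $Q(e',m',X)$ for which there is $y\in{}^{\omega}\omega$ with $\langle\langle e',(m',k),X\rangle,y(k)\rangle\in C$ for all $k\in\omega$, and each such query is answered by $\mathsf{E}(y)$. Let $\Gamma_\infty$ be the least fixed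 point of the monotone operator $\Gamma$, obtained by iteration from $\emptyset$. Then $\{e\}^{\mathsf{E}}(m,X)$ converges with value $n$ iff $\langle\langle e,m,X\rangle,n\rangle\in\Gamma_\infty$; it is undefined (divergent) if there is no such $n$. **Feedback computation.** Programs are ordinary oracle Turing machine programs (with oracle $X$), indexed by $e\in\omega$ in a standard way, with an additional instruction allowing the machine at any stage to issue a query $Q^X(e',m')$, with $e',m'$ integers computed by the machine, asking whether the feedback computation $\langle e'\rangle^X(m')$ converges or diverges, and receiving (in one step) an answer in $\{\downarrow,\uparrow\}$. Formally, for a partial function $C$ let $I(C)$ be the set of pairs $\langle\langle e,m,X\rangle,\langle j,k\rangle\rangle$ such that program $e$, run on input $m$ with oracle $X$, makes only queries $Q^X(e',m')$ for which $C(\langle e',m',X\rangle)=\langle j',k'\rangle$ is defined, each such query being answered by $j'$, and either this run halts with output $k\in\omega$ and $j=\,\downarrow$, or it runs forever and $j=\,\uparrow$, $k=\omega$. Let $I_\infty$ be the least fixed point of the monotone operator $I$, obtained by iteration from $\emptyset$. Then $\langle e\rangle^X(m)$ converges with value $k$ iff $I_\infty(\langle e,m,X\rangle)=\langle\downarrow,k\rangle$; it diverges iff $I_\infty(\langle e,m,X\rangle)=\langle\uparrow,\omega\rangle$; and it is freezing (undefined) iff $\langle e,m,X\rangle\notin\mathrm{dom}(I_\infty)$. Both the divergent and the freezing case count as "not converging" in $\simeq$. -}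

module Defs where

open import Data.Bool.Base using (if_then_else_)
open import Data.Fin.Base using (Fin)
open import Data.List.Base as List using (List; []; _∷_)
open import Data.Maybe.Base using (Maybe; just; nothing)
open import Data.Nat.Base using (ℕ; zero; suc; _+_; _≡ᵇ_)
open import Data.Product.Base using (∃; ∃-syntax; Σ-syntax; _×_; _,_; proj₁; proj₂)
open import Data.Vec.Base as Vec using (Vec; []; _∷_)
open import Function.Bundles using (_⇔_)
open import Relation.Binary.Construct.Closure.ReflexiveTransitive using (Star)
open import Relation.Binary.PropositionalEquality using (_≡_; _≢_)

------------------------------------------------------------------------
-- Primitive recursive functions

data PR : ℕ → Set where
  zero : PR 0
  suc  : PR 1
  proj : ∀ {n} → Fin n → PR n
  comp : ∀ {m n} → PR m → Vec (PR n) m → PR n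
  rec  : ∀ {n} → PR n → PR (suc (suc n)) → PR (suc n)

mutual
  ⟦_⟧ : ∀ {n} → PR n → Vec ℕ n → ℕ
  ⟦ zero ⟧     _        = 0
  ⟦ suc ⟧      (x ∷ []) = suc x
  ⟦ proj i ⟧   xs       = Vec.lookup xs i
  ⟦ comp f gs ⟧ xs      = ⟦ f ⟧ (⟦ gs ⟧* xs)
  ⟦ rec f g ⟧  (x ∷ xs) = primrec f g x xs

  ⟦_⟧* : ∀ {m n} → Vec (PR n) m → Vec ℕ n → Vec ℕ m
  ⟦ [] ⟧*     xs = []
  ⟦ g ∷ gs ⟧* xs = ⟦ g ⟧ xs ∷ ⟦ gs ⟧* xs

  primrec : ∀ {n} → PR n → PR (suc (suc n)) → ℕ → Vec ℕ n → ℕ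
  primrec f g zero    xs = ⟦ f ⟧ xs
  primrec f g (suc x) xs = ⟦ g ⟧ (x ∷ primrec f g x xs ∷ xs)

PrimitiveRecursive : (ℕ → ℕ) → Set
PrimitiveRecursive f = ∃[ p ] (∀ x → ⟦ p ⟧ (x ∷ []) ≡ f x)

------------------------------------------------------------------------
-- Coding of pairs: the Cantor bijection, enumerating each antidiagonal
-- as (s , 0), (s ∸ 1 , 1), …, (0 , s).  `unpair` is the inverse of `pair`.

triangle : ℕ → ℕ
triangle zero    = 0
triangle (suc n) = suc n + triangle n

pair : ℕ → ℕ → ℕ
pair a b = triangle (a + b) + b

successor : ℕ × ℕ → ℕ × ℕ
successor (zero  , b) = suc b , 0
successor (suc a , b) = a , suc b

unpair : ℕ → ℕ × ℕ
unpair zero    = 0 , 0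
unpair (suc n) = successor (unpair n)

------------------------------------------------------------------------
-- Oracle Turing machines with a query instruction
--
-- The machines have several two-way infinite tapes over a one-letter
-- alphabet plus blank, and act on one tape at a time.  Tapes are numbered
-- by ℕ; a program, being finite, mentions only finitely many of them.

data Symbol : Set where
  blank one : Symbol

data Move : Set where
  left stay right : Move

record Action : Set where
  constructor action
  field
    write : Symbol
    move  : Move
    goto  : ℕ

-- Programs are lists of instructions, and states are positions in the list;
-- a machine halts by entering a state that has no instruction.
data Instruction : Set where
  -- on tape t, perform the first action if blank is scanned, else the second
  act    : (t : ℕ) → Action → Action → Instruction
  -- put X(n) on tape t, where n is the integer on tape s, and go to state q
  oracle : (s t q : ℕ) → Instruction
  -- query the pair of integers on tapes s and s′, put the answer on tape t,
  -- and go to state q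
  query  : (s s′ t q : ℕ) → Instruction

Program : Set
Program = List Instruction

-- The cells left of the head (nearest first), the scanned cell, and the
-- cells right of it (nearest first); cells not listed are blank.
record Tape : Set where
  constructor tape
  field
    before  : List Symbol
    scanned : Symbol
    after   : List Symbol

uncons : List Symbol → Symbol × List Symbol
uncons []       = blank , []
uncons (a ∷ as) = a , as

shift : Move → Tape → Tape
shift left  (tape ls a rs) =
  tape (proj₂ (uncons ls)) (proj₁ (uncons ls)) (a ∷ rs)
shift stay  T              = T
shift right (tape ls a rs) =
  tape (a ∷ ls) (proj₁ (uncons rs)) (proj₂ (uncons rs))

ones : List Symbol → ℕ
ones []           = 0
ones (blank ∷ as) = ones as
ones (one   ∷ as) = suc (ones as)

-- The integer on a tape is the number of its non-blank cells.
value : Tape → ℕ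
value (tape ls a rs) = ones ls + ones (a ∷ rs)

blankTape : Tape
blankTape = tape [] blank []

unary : ℕ → Tape
unary zero    = blankTape
unary (suc n) = tape [] one (List.replicate n one)

record Config : Set where
  constructor config
  field
    state : ℕ
    tapes : ℕ → Tape

_[_≔_] : (ℕ → Tape) → ℕ → Tape → (ℕ → Tape)
(T [ t ≔ S ]) i = if i ≡ᵇ t then S else T i

-- Tape 0 carries the input, and, on halting, the output.
initial : ℕ → Config
initial m = config 0 ((λ _ → blankTape) [ 0 ≔ unary m ])

data Status : Set where
  halted  : (output : ℕ) → Status
  moves   : Config → Status
  asks    : (e′ m′ : ℕ) (resume : ℕ → Config) → Status

perform : Action → ℕ → (ℕ → Tape) → Config
perform (action b d q) t T =
  config q (T [ t ≔ shift d (record (T t) { scanned = b }) ])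

choose : Symbol → Action → Action → Action
choose blank α β = α
choose one   α β = β

execute : (ℕ → ℕ) → Maybe Instruction → (ℕ → Tape) → Status
execute X nothing                 T = halted (value (T 0))
execute X (just (act t α β))      T =
  moves (perform (choose (Tape.scanned (T t)) α β) t T)
execute X (just (oracle s t q))   T =
  moves (config q (T [ t ≔ unary (X (value (T s))) ]))
execute X (just (query s s′ t q)) T =
  asks (value (T s)) (value (T s′)) (λ a → config q (T [ t ≔ unary a ]))

status : Program → (ℕ → ℕ) → Config → Status
status P X (config q T) = execute X (List.head (List.drop q P)) T

-- `A e′ m′ a` says that a query about e′ and m′ is answered by a.  A run
-- cannot proceed past a query that has no answer.
Answers : Set₁
Answers = ℕ → ℕ → ℕ → Set

data Step (P : Program) (X : ℕ → ℕ) (A : Answers) (c : Config) :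
          Config → Set where
  compute : ∀ {c′} → status P X c ≡ moves c′ → Step P X A c c′
  answer  : ∀ {e′ m′ resume a} → status P X c ≡ asks e′ m′ resume →
            A e′ m′ a → Step P X A c (resume a)

HaltsWith : Program → (ℕ → ℕ) → Answers → ℕ → ℕ → Set
HaltsWith P X A m n =
  ∃[ c ] (Star (Step P X A) (initial m) c × status P X c ≡ halted n)

RunsForever : Program → (ℕ → ℕ) → Answers → ℕ → Set
RunsForever P X A m =
  Σ[ run ∈ (ℕ → Config) ]
    (run 0 ≡ initial m × (∀ i → Step P X A (run i) (run (suc i))))

------------------------------------------------------------------------
-- Indexing of programs
--
-- Every number is an index, and every program has one.

toSymbol : ℕ → Symbol
toSymbol zero    = blank
toSymbol (suc _) = one

toMove : ℕ → Move
toMove 0 = left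
toMove 1 = stay
toMove _ = right

toAction : ℕ → Action
toAction c =
  let b , r = unpair c
      d , q = unpair r
  in action (toSymbol b) (toMove d) q

toInstruction′ : (tag body : ℕ) → Instruction
toInstruction′ 0 c =
  let t , r = unpair c
      α , β = unpair r
  in act t (toAction α) (toAction β)
toInstruction′ 1 c =
  let s , r = unpair c
      t , q = unpair r
  in oracle s t q
toInstruction′ _ c =
  let s  , r  = unpair c
      s′ , r′ = unpair r
      t  , q  = unpair r′
  in query s s′ t q

toInstruction : ℕ → Instruction
toInstruction c = toInstruction′ (proj₁ (unpair c)) (proj₂ (unpair c))

-- 0 codes the empty list and suc (pair x y) the list with head coded by x and
-- tail coded by y.  Since y ≤ pair x y, the bound e below is never reached
-- before the code is exhausted.
toProgram : (bound code : ℕ) → Program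
toProgram zero    _       = []
toProgram (suc _) zero    = []
toProgram (suc k) (suc c) =
  toInstruction (proj₁ (unpair c)) ∷ toProgram k (proj₂ (unpair c))

program : ℕ → Program
program e = toProgram e e

------------------------------------------------------------------------
-- Kleene recursion in E

-- The graph of E, which is not a computable function.
data E (y : ℕ → ℕ) : ℕ → Set where
  some-zero : (∃[ n ] y n ≡ 0) → E y 0
  no-zero   : (∀ n → y n ≢ 0)  → E y 1

-- `C e m X n` stands for ⟨⟨e, m, X⟩, n⟩ ∈ C.
E-Answers : (ℕ → ℕ → (ℕ → ℕ) → ℕ → Set) → (ℕ → ℕ) → Answers
E-Answers C X e′ m′ a =
  ∃[ y ] ((∀ k → C e′ (pair m′ k) X (y k)) × E y a)

Γ : (ℕ → ℕ → (ℕ → ℕ) → ℕ → Set) → (ℕ → ℕ → (ℕ → ℕ) → ℕ → Set)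
Γ C e m X n = HaltsWith (program e) X (E-Answers C X) m n

data Γ∞ (e m : ℕ) (X : ℕ → ℕ) (n : ℕ) : Set where
  fold : Γ Γ∞ e m X n → Γ∞ e m X n

------------------------------------------------------------------------
-- Feedback computation

data Signal : Set where
  ↓ ↑ : Signal

-- The possible values ⟨↓, k⟩ and ⟨↑, ω⟩.
data Outcome : Set where
  ⟨↓,_⟩ : ℕ → Outcome
  ⟨↑,ω⟩ : Outcome

signal : Outcome → Signal
signal ⟨↓, _ ⟩ = ↓
signal ⟨↑,ω⟩   = ↑

-- How a signal is presented to the machine on the answer tape.
signalCode : Signal → ℕ
signalCode ↓ = 0
signalCode ↑ = 1

-- `C e m X o` stands for C(⟨e, m, X⟩) = o: partial functions are given by
-- their graphs.
I-Answers : (ℕ → ℕ → (ℕ → ℕ) → Outcome → Set) → (ℕ → ℕ) → Answers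
I-Answers C X e′ m′ a = ∃[ o ] (C e′ m′ X o × a ≡ signalCode (signal o))

data I (C : ℕ → ℕ → (ℕ → ℕ) → Outcome → Set) (e m : ℕ) (X : ℕ → ℕ) :
       Outcome → Set where
  halts : ∀ {k} → HaltsWith (program e) X (I-Answers C X) m k →
          I C e m X ⟨↓, k ⟩
  runs  : RunsForever (program e) X (I-Answers C X) m → I C e m X ⟨↑,ω⟩

data I∞ (e m : ℕ) (X : ℕ → ℕ) (o : Outcome) : Set where
  fold : I I∞ e m X o → I∞ e m X o

------------------------------------------------------------------------
-- Partial values

-- A partial value is given by the relation "converges with value n".
Partial : Set₁
Partial = ℕ → Set

infix 4 _≃_

-- Either both sides converge and have the same value, or neither converges;
-- stated without asking for a decision between the two cases.
_≃_ : Partial → Partial → Set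
p ≃ q = (∃ p ⇔ ∃ q) × (∀ {a b} → p a → q b → a ≡ b)

⟨_⟩^_[_] : ℕ → (ℕ → ℕ) → ℕ → Partial
⟨ e ⟩^ X [ m ] = λ k → I∞ e m X ⟨↓, k ⟩

❴_❵ᴱ[_,_] : ℕ → ℕ → (ℕ → ℕ) → Partial
❴ e ❵ᴱ[ m , X ] = λ n → Γ∞ e m X n

{-# OPTIONS --safe #-}

-- A universal program u simulates, on input (⟨u, e, m⟩, k), the first k steps of the feedback
-- computation ⟨e⟩(m), and returns 0 if it has halted by then and 1 otherwise.  Whenever the
-- simulated machine asks whether ⟨e′⟩(m′) converges, u asks for E of its own values at
-- (⟨u, e′, m′⟩, k), k = 0, 1, …: all of these are defined iff ⟨e′⟩(m′) is not freezing, and one of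
-- them is 0 iff it halts, so that the answer is the code of ↓ or ↑.  As its index is part of its
-- input, u needs no recursion theorem.  The program with index k₁(e) is the same interpreter without
-- a bound on the number of steps, preceded by instructions that write down e and u.  Both directions
-- are inductions on the least fixed points.
--
-- The interpreter is primitive recursive up to its queries, and primitive recursive functions are
-- compiled to tape machines by using tapes as counters.

module Submission where

open import Defs
open import Data.Bool.Base as Bool using (if_then_else_; true; false)
open import Data.Empty using (⊥; ⊥-elim)
open import Data.Fin.Base using (Fin; zero; suc)
open import Data.List.Base as List using (List; []; _∷_; _++_; _∷ʳ_; length; replicate)
open import Data.List.Properties using (++-assoc; ++-identityʳ; length-++)
open import Data.List.Relation.Unary.All using (All; []; _∷_)
open import Data.Maybe.Base using (Maybe; just; nothing)
open import Data.Nat.Base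
open import Data.Nat.Properties
open import Data.Product.Base using (∃-syntax; _×_; _,_; proj₁; proj₂)
open import Data.Sum.Base using (_⊎_; inj₁; inj₂)
open import Data.Unit.Base using (⊤; tt)
open import Data.Vec.Base as Vec using (Vec; []; _∷_)
open import Data.Vec.Properties using (length-toList)
open import Data.Vec.Relation.Binary.Pointwise.Inductive as Pointwise using (Pointwise; []; _∷_)
open import Function.Bundles using (mk⇔)
open import Relation.Binary.Construct.Closure.ReflexiveTransitive as Star using (Star; ε; _◅_; _◅◅_)
open import Relation.Binary.PropositionalEquality

-- A simulation bound k gives a value whenever the simulated run halts or goes on forever; a run
-- stuck at a freezing query leaves the values for large k undefined, so the query to `E` is stuck
-- as well. Conversely, the answer 1 supplies only separate finite runs, one of each length. They
-- join into one infinite run since runs are deterministic, which rests on the single-valuedness of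
-- feedback computation. The cases of halting and diverging are never decided but read off from
-- derivations.
--
-- Both interpreters belong to one family `machine N`, where `N` is a number written down at the
-- start: 0 gives the bounded interpreter, and `suc (pair u e)` the unbounded one for e. So `k₁` is
-- primitive recursive once the code of `machine N` is so in `N`.
--
-- A configuration contains a function from numbers to tapes, which has no code and whose equality
-- is not extensional. The interpreter therefore stores a list of tape updates, and the
-- configuration simulated is by definition the outcome of these updates.

-- Pairing

pair-sucʳ : ∀ a b → pair a (suc b) ≡ suc (pair (suc a) b)
pair-sucʳ a b = trans (cong (λ s → triangle s + suc b) (+-suc a b)) (+-suc (triangle (suc a + b)) b)

pair-sucˡ : ∀ a → pair (suc a) 0 ≡ suc (pair 0 a)
pair-sucˡ a rewrite +-identityʳ a | +-identityʳ (a + triangle a) = cong suc (+-comm a (triangle a))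

-- The induction walks the enumeration backwards: `b` decreases along an antidiagonal, and at `b` =
-- 0 the walk passes to the last point of the previous one.
unpair-pair : ∀ a b → unpair (pair a b) ≡ (a , b)
unpair-pair a b = go (a + b) a b refl
  where
  go : ∀ s a b → a + b ≡ s → unpair (pair a b) ≡ (a , b)
  go s zero zero eq = refl
  go s a (suc b) eq = trans (cong unpair (pair-sucʳ a b))
    (cong successor (go s (suc a) b (trans (sym (+-suc a b)) eq)))
  go (suc s) (suc a) zero eq = trans (cong unpair (pair-sucˡ a))
    (cong successor (go s 0 a (suc-injective (trans (cong suc (sym (+-identityʳ a))) eq))))

pair-unpair : ∀ n → pair (proj₁ (unpair n)) (proj₂ (unpair n)) ≡ n
pair-unpair zero    = refl
pair-unpair (suc n) = trans (pair-successor (unpair n)) (cong suc (pair-unpair n))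
  where
  pair-successor : ∀ p → pair (proj₁ (successor p)) (proj₂ (successor p)) ≡ suc (pair (proj₁ p) (proj₂ p))
  pair-successor (zero  , b) = pair-sucˡ b
  pair-successor (suc a , b) = pair-sucʳ a b

b≤pair : ∀ a b → b ≤ pair a b
b≤pair a b = m≤n+m b (triangle (a + b))

π₁ π₂ : ℕ → ℕ
π₁ n = proj₁ (unpair n)
π₂ n = proj₂ (unpair n)

π₁-pair : ∀ a b → π₁ (pair a b) ≡ a
π₁-pair a b = cong proj₁ (unpair-pair a b)

π₂-pair : ∀ a b → π₂ (pair a b) ≡ b
π₂-pair a b = cong proj₂ (unpair-pair a b)

π₂≤ : ∀ n → π₂ n ≤ n
π₂≤ n = subst (π₂ n ≤_) (pair-unpair n) (b≤pair (π₁ n) (π₂ n))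

-- Primitive recursive terms together with the functions they denote

natrec : {A : Set} → A → (ℕ → A → A) → ℕ → A
natrec z s zero    = z
natrec z s (suc n) = s n (natrec z s n)

ifz : ℕ → ℕ → ℕ → ℕ
ifz zero    a b = a
ifz (suc _) a b = b

record Prim (n : ℕ) : Set where
  constructor mkPrim
  field
    fun     : Vec ℕ n → ℕ
    term    : PR n
    correct : ∀ xs → ⟦ term ⟧ xs ≡ fun xs
open Prim public

funs : ∀ {m n} → Vec (Prim n) m → Vec ℕ n → Vec ℕ m
funs []       xs = []
funs (g ∷ gs) xs = fun g xs ∷ funs gs xs

terms : ∀ {m n} → Vec (Prim n) m → Vec (PR n) m
terms []       = []
terms (g ∷ gs) = term g ∷ terms gs

terms-correct : ∀ {m n} (gs : Vec (Prim n) m) xs → ⟦ terms gs ⟧* xs ≡ funs gs xs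
terms-correct []       xs = refl
terms-correct (g ∷ gs) xs = cong₂ _∷_ (correct g xs) (terms-correct gs xs)

var : ∀ {n} → Fin n → Prim n
var i = mkPrim (λ xs → Vec.lookup xs i) (proj i) (λ _ → refl)

call : ∀ {m n} → Prim m → Vec (Prim n) m → Prim n
call f gs = mkPrim (λ xs → fun f (funs gs xs)) (comp (term f) (terms gs))
  (λ xs → trans (cong ⟦ term f ⟧ (terms-correct gs xs)) (correct f (funs gs xs)))

restate : ∀ {n} (f : Prim n) (g : Vec ℕ n → ℕ) → (∀ xs → fun f xs ≡ g xs) → Prim n
restate f g eq = mkPrim g (term f) (λ xs → trans (correct f xs) (eq xs))

recursion : ∀ {n} → Prim n → Prim (suc (suc n)) → Prim (suc n)
recursion {n} f g = mkPrim
  (λ { (x ∷ xs) → natrec (fun f xs) (λ i r → fun g (i ∷ r ∷ xs)) x })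
  (rec (term f) (term g))
  (λ { (x ∷ xs) → agrees x xs })
  where
  agrees : ∀ x xs → primrec (term f) (term g) x xs ≡ natrec (fun f xs) (λ i r → fun g (i ∷ r ∷ xs)) x
  agrees zero    xs = correct f xs
  agrees (suc x) xs = trans (cong (λ r → ⟦ term g ⟧ (x ∷ r ∷ xs)) (agrees x xs)) (correct g _)

sucᵖ : ∀ {n} → Prim n → Prim n
sucᵖ f = call (mkPrim (λ { (x ∷ []) → suc x }) suc (λ { (x ∷ []) → refl })) (f ∷ [])

lit : ∀ {n} → ℕ → Prim n
lit zero    = call (mkPrim (λ _ → 0) zero (λ _ → refl)) []
lit (suc k) = sucᵖ (lit k)

lit-fun : ∀ {n} k (xs : Vec ℕ n) → fun (lit k) xs ≡ k
lit-fun zero    xs = refl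
lit-fun (suc k) xs = cong suc (lit-fun k xs)

x₀ : ∀ {n} → Prim (1 + n)
x₀ = var zero
x₁ : ∀ {n} → Prim (2 + n)
x₁ = var (suc zero)
x₂ : ∀ {n} → Prim (3 + n)
x₂ = var (suc (suc zero))
x₃ : ∀ {n} → Prim (4 + n)
x₃ = var (suc (suc (suc zero)))
x₄ : ∀ {n} → Prim (5 + n)
x₄ = var (suc (suc (suc (suc zero))))
x₅ : ∀ {n} → Prim (6 + n)
x₅ = var (suc (suc (suc (suc (suc zero)))))
x₆ : ∀ {n} → Prim (7 + n)
x₆ = var (suc (suc (suc (suc (suc (suc zero))))))

infixl 6 _+ᵖ_ _∸ᵖ_
_+ᵖ_ _∸ᵖ_ pairᵖ : ∀ {n} → Prim n → Prim n → Prim n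

f +ᵖ g = call (restate (recursion x₀ (sucᵖ x₁)) (λ { (x ∷ y ∷ []) → x + y }) (λ { (x ∷ y ∷ []) → agrees x y }))
  (f ∷ g ∷ [])
  where
  agrees : ∀ x y → natrec y (λ _ → suc) x ≡ x + y
  agrees zero    y = refl
  agrees (suc x) y = cong suc (agrees x y)

predᵖ : ∀ {n} → Prim n → Prim n
predᵖ f = call (restate (recursion (lit 0) x₀) (λ { (x ∷ []) → pred x })
  (λ { (zero ∷ []) → refl ; (suc _ ∷ []) → refl })) (f ∷ [])

f ∸ᵖ g = call (restate (recursion x₀ (predᵖ x₁)) (λ { (y ∷ x ∷ []) → x ∸ y }) (λ { (y ∷ x ∷ []) → agrees y x }))
  (g ∷ f ∷ [])
  where
  agrees : ∀ y x → natrec x (λ _ → pred) y ≡ x ∸ y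
  agrees zero    x = refl
  agrees (suc y) x = trans (cong pred (agrees y x)) (pred[m∸n]≡m∸[1+n] x y)

ifzᵖ : ∀ {n} → Prim n → Prim n → Prim n → Prim n
ifzᵖ c f g = call (restate (recursion x₀ x₃) (λ { (z ∷ x ∷ y ∷ []) → ifz z x y })
  (λ { (zero ∷ x ∷ y ∷ []) → refl ; (suc _ ∷ x ∷ y ∷ []) → refl })) (c ∷ f ∷ g ∷ [])

triangleᵖ : ∀ {n} → Prim n → Prim n
triangleᵖ f = call (restate (recursion (lit 0) (sucᵖ x₀ +ᵖ x₁)) (λ { (x ∷ []) → triangle x })
  (λ { (x ∷ []) → agrees x })) (f ∷ [])
  where
  agrees : ∀ x → natrec 0 (λ i r → suc i + r) x ≡ triangle x
  agrees zero    = refl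
  agrees (suc x) = cong (suc x +_) (agrees x)

pairᵖ f g = call (mkPrim (λ { (x ∷ y ∷ []) → pair x y }) (term p) (λ { (x ∷ y ∷ []) → correct p (x ∷ y ∷ []) }))
  (f ∷ g ∷ [])
  where
  p : Prim 2
  p = triangleᵖ (x₀ +ᵖ x₁) +ᵖ x₁

ifeq : ℕ → ℕ → ℕ → ℕ → ℕ
ifeq i j a b = ifz ((i ∸ j) + (j ∸ i)) a b

ifeq-≡ᵇ : ∀ i j a b → ifeq i j a b ≡ (if i ≡ᵇ j then a else b)
ifeq-≡ᵇ zero    zero    a b = refl
ifeq-≡ᵇ zero    (suc j) a b = refl
ifeq-≡ᵇ (suc i) zero    a b = refl
ifeq-≡ᵇ (suc i) (suc j) a b = ifeq-≡ᵇ i j a b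

ifeq-refl : ∀ i a b → ifeq i i a b ≡ a
ifeq-refl zero    a b = refl
ifeq-refl (suc i) a b = ifeq-refl i a b

ifeq-< : ∀ {i j} → i < j → ∀ a b → ifeq i j a b ≡ b
ifeq-< {zero}  {suc j} _         a b = refl
ifeq-< {suc i} {suc j} (s≤s i<j) a b = ifeq-< i<j a b

ifeqᵖ : ∀ {n} → Prim n → Prim n → Prim n → Prim n → Prim n
ifeqᵖ i j f g = ifzᵖ ((i ∸ᵖ j) +ᵖ (j ∸ᵖ i)) f g

-- A primitive recursion yields one number, while `unpair` iterates on pairs. The sum of the
-- components obeys a recursion of its own, and the second component is then
-- `n ∸ triangle (diagonal n)`.
diagonal : ℕ → ℕ
diagonal n = π₁ n + π₂ n

-- The antidiagonal changes after its last point, which is pair 0 s = triangle s + s.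
diagonal-suc : ∀ n →
  diagonal (suc n) ≡ ifeq n (triangle (diagonal n) + diagonal n) (suc (diagonal n)) (diagonal n)
diagonal-suc n = trans (successor-diagonal (unpair n))
  (cong (λ k → ifeq k (triangle (diagonal n) + diagonal n) (suc (diagonal n)) (diagonal n)) (pair-unpair n))
  where
  successor-diagonal : ∀ p → let a = proj₁ p ; b = proj₂ p in
    proj₁ (successor p) + proj₂ (successor p) ≡
    ifeq (pair a b) (triangle (a + b) + (a + b)) (suc (a + b)) (a + b)
  successor-diagonal (zero  , b) = trans (+-identityʳ (suc b)) (sym (ifeq-refl (triangle b + b) _ _))
  successor-diagonal (suc a , b) =
    trans (+-suc a b) (sym (ifeq-< (+-monoʳ-< (triangle (suc a + b)) (s≤s (m≤n+m b a))) _ _))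

diagonalᵖ : ∀ {n} → Prim n → Prim n
diagonalᵖ f = call (restate
  (recursion (lit 0) (ifeqᵖ x₀ (triangleᵖ x₁ +ᵖ x₁) (sucᵖ x₁) x₁))
  (λ { (x ∷ []) → diagonal x }) (λ { (x ∷ []) → agrees x })) (f ∷ [])
  where
  agrees : ∀ x → natrec 0 (λ i r → ifeq i (triangle r + r) (suc r) r) x ≡ diagonal x
  agrees zero    = refl
  agrees (suc x) rewrite agrees x = sym (diagonal-suc x)

π₁ᵖ π₂ᵖ : ∀ {n} → Prim n → Prim n
π₂ᵖ f = call (restate (x₀ ∸ᵖ triangleᵖ (diagonalᵖ x₀)) (λ { (x ∷ []) → π₂ x }) (λ { (x ∷ []) → agrees x })) (f ∷ [])
  where
  agrees : ∀ x → x ∸ triangle (diagonal x) ≡ π₂ x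
  agrees x = trans (cong (_∸ triangle (diagonal x)) (sym (pair-unpair x))) (m+n∸m≡n (triangle (diagonal x)) (π₂ x))
π₁ᵖ f = call (restate (diagonalᵖ x₀ ∸ᵖ π₂ᵖ x₀) (λ { (x ∷ []) → π₁ x }) (λ { (x ∷ []) → m+n∸n≡m (π₁ x) (π₂ x) })) (f ∷ [])

-- Lists

-- On the code 0 of the empty list, hd and tl return 0.
hd tl : ℕ → ℕ
hd c = π₁ (pred c)
tl c = π₂ (pred c)

cons : ℕ → ℕ → ℕ
cons a c = suc (pair a c)

hdᵖ tlᵖ : ∀ {n} → Prim n → Prim n
hdᵖ f = π₁ᵖ (predᵖ f)
tlᵖ f = π₂ᵖ (predᵖ f)

consᵖ : ∀ {n} → Prim n → Prim n → Prim n
consᵖ f g = sucᵖ (pairᵖ f g)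

encodeList : {A : Set} → (A → ℕ) → List A → ℕ
encodeList f []       = 0
encodeList f (a ∷ as) = cons (f a) (encodeList f as)

-- Justifies using the code of a list as the number of iterations of a loop over it.
length≤encodeList : {A : Set} (f : A → ℕ) (as : List A) → length as ≤ encodeList f as
length≤encodeList f []       = z≤n
length≤encodeList f (a ∷ as) = s≤s (≤-trans (length≤encodeList f as) (b≤pair (f a) _))

-- `natrec` exposes the last iteration, whereas invariants of loops over lists concern the first.
natrec-shift : {A : Set} (s : A → A) (z : A) (n : ℕ) → natrec z (λ _ → s) (suc n) ≡ natrec (s z) (λ _ → s) n
natrec-shift s z zero    = refl
natrec-shift s z (suc n) = cong s (natrec-shift s z n)

natrec-fixed : {A : Set} (s : A → A) (z : A) → s z ≡ z → ∀ n → natrec z (λ _ → s) n ≡ z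
natrec-fixed s z eq zero    = refl
natrec-fixed s z eq (suc n) = trans (cong s (natrec-fixed s z eq n)) eq

-- Interpretation of coded programs and tapes

fetch : ℕ → ℕ → ℕ
fetch e q = natrec e (λ _ → tl) q

fetchᵖ : ∀ {n} → Prim n → Prim n → Prim n
fetchᵖ f g = call (restate (recursion x₀ (tlᵖ x₁)) (λ { (q ∷ e ∷ []) → fetch e q }) (λ { (q ∷ e ∷ []) → refl }))
  (g ∷ f ∷ [])

decodeInstruction : ℕ → Maybe Instruction
decodeInstruction zero    = nothing
decodeInstruction (suc c) = just (toInstruction (π₁ c))

-- Tails have smaller codes, so the bound `k` never cuts the program short; beyond its end `tl`
-- stays at 0, which decodes to no instruction.
fetch-toProgram : ∀ q k c → c ≤ k → List.head (List.drop q (toProgram k c)) ≡ decodeInstruction (fetch c q)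
fetch-toProgram q       zero    zero    _ = trans (head-drop-[] q)
  (cong decodeInstruction (sym (natrec-fixed tl 0 refl q)))
  where
  head-drop-[] : ∀ q → List.head (List.drop q (List.List.[] {A = Instruction})) ≡ nothing
  head-drop-[] zero    = refl
  head-drop-[] (suc q) = refl
fetch-toProgram zero    (suc k) zero    _ = refl
fetch-toProgram (suc q) (suc k) zero    _ = cong decodeInstruction (sym (natrec-fixed tl 0 refl (suc q)))
fetch-toProgram zero    (suc k) (suc c) _ = refl
fetch-toProgram (suc q) (suc k) (suc c) (s≤s c≤k) =
  trans (fetch-toProgram q k (π₂ c) (≤-trans (π₂≤ c) c≤k)) (cong decodeInstruction (sym (natrec-shift tl (suc c) q)))

encodeSymbol : Symbol → ℕ
encodeSymbol blank = 0
encodeSymbol one   = 1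

encodeSymbols : List Symbol → ℕ
encodeSymbols = encodeList encodeSymbol

encodeTape : Tape → ℕ
encodeTape (tape ls a rs) = pair (encodeSymbols ls) (pair (encodeSymbol a) (encodeSymbols rs))

-- The state pairs the count with the remaining list. Symbol codes are 0 and 1, hence can be added
-- directly, and an exhausted list contributes `hd 0`, which is 0.
count-step : ℕ → ℕ
count-step s = pair (π₁ s + hd (π₂ s)) (tl (π₂ s))

countOnes : ℕ → ℕ
countOnes c = π₁ (natrec (pair 0 c) (λ _ → count-step) c)

countOnesᵖ : ∀ {n} → Prim n → Prim n
countOnesᵖ f = call (restate
  (π₁ᵖ (call (recursion (pairᵖ (lit 0) x₀) (pairᵖ (π₁ᵖ x₁ +ᵖ hdᵖ (π₂ᵖ x₁)) (tlᵖ (π₂ᵖ x₁)))) (x₀ ∷ x₀ ∷ [])))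
  (λ { (c ∷ []) → countOnes c }) (λ { (c ∷ []) → refl })) (f ∷ [])

countOnes-correct : ∀ as → countOnes (encodeSymbols as) ≡ ones as
countOnes-correct as = go (encodeSymbols as) 0 as (length≤encodeList encodeSymbol as)
  where
  go : ∀ k acc as → length as ≤ k →
    π₁ (natrec (pair acc (encodeSymbols as)) (λ _ → count-step) k) ≡ acc + ones as
  go zero    acc []       _ = trans (π₁-pair acc 0) (sym (+-identityʳ acc))
  go (suc k) acc []       _
    rewrite natrec-shift count-step (pair acc 0) k | unpair-pair acc 0 | +-identityʳ acc =
    trans (go k acc [] z≤n) (+-identityʳ acc)
  go (suc k) acc (a ∷ as) (s≤s le)
    rewrite natrec-shift count-step (pair acc (encodeSymbols (a ∷ as))) k
      | unpair-pair acc (encodeSymbols (a ∷ as)) | unpair-pair (encodeSymbol a) (encodeSymbols as) =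
    trans (go k (acc + encodeSymbol a) as le) (trans (+-assoc acc _ _) (cong (acc +_) (ones-∷ a)))
    where
    ones-∷ : ∀ a → encodeSymbol a + ones as ≡ ones (a ∷ as)
    ones-∷ blank = refl
    ones-∷ one   = refl

-- The successor of `π₂ T` is the code of the list made of the scanned cell and the cells to its
-- right.
valueᶜ : ℕ → ℕ
valueᶜ T = countOnes (π₁ T) + countOnes (suc (π₂ T))

valueᵖ : ∀ {n} → Prim n → Prim n
valueᵖ f = call (restate (countOnesᵖ (π₁ᵖ x₀) +ᵖ countOnesᵖ (sucᵖ (π₂ᵖ x₀)))
  (λ { (T ∷ []) → valueᶜ T }) (λ { (T ∷ []) → refl })) (f ∷ [])

valueᶜ-correct : ∀ T → valueᶜ (encodeTape T) ≡ value T
valueᶜ-correct (tape ls a rs)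
  rewrite unpair-pair (encodeSymbols ls) (pair (encodeSymbol a) (encodeSymbols rs)) =
  cong₂ _+_ (countOnes-correct ls) (countOnes-correct (a ∷ rs))

-- The predecessor of the code of a list of ones pairs the first one with the rest; for the empty
-- list it is 0, which is `pair 0 0`, a blank cell with nothing after it.
unaryᶜ : ℕ → ℕ
unaryᶜ n = pair 0 (pred (natrec 0 (λ _ → cons 1) n))

unaryᵖ : ∀ {n} → Prim n → Prim n
unaryᵖ f = call (restate (pairᵖ (lit 0) (predᵖ (call (recursion (lit 0) (consᵖ (lit 1) x₁)) (x₀ ∷ []))))
  (λ { (k ∷ []) → unaryᶜ k }) (λ { (k ∷ []) → refl })) (f ∷ [])

unaryᶜ-correct : ∀ n → unaryᶜ n ≡ encodeTape (unary n)
unaryᶜ-correct zero    = refl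
unaryᶜ-correct (suc n) = cong (λ c → pair 0 (pair 1 c)) (replicate-correct n)
  where
  replicate-correct : ∀ n → natrec 0 (λ _ → cons 1) n ≡ encodeSymbols (replicate n one)
  replicate-correct zero    = refl
  replicate-correct (suc n) = cong (cons 1) (replicate-correct n)

shiftᶜ : ℕ → ℕ → ℕ → ℕ → ℕ
shiftᶜ d ls a rs = ifz d (pair (tl ls) (pair (hd ls) (cons a rs)))
  (ifz (pred d) (pair ls (pair a rs)) (pair (cons a ls) (pair (hd rs) (tl rs))))

uncons-hd : ∀ as → hd (encodeSymbols as) ≡ encodeSymbol (proj₁ (uncons as))
uncons-hd []       = refl
uncons-hd (a ∷ as) = π₁-pair (encodeSymbol a) (encodeSymbols as)

uncons-tl : ∀ as → tl (encodeSymbols as) ≡ encodeSymbols (proj₂ (uncons as))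
uncons-tl []       = refl
uncons-tl (a ∷ as) = π₂-pair (encodeSymbol a) (encodeSymbols as)

shiftᶜ-correct : ∀ d ls a rs → shiftᶜ d (encodeSymbols ls) (encodeSymbol a) (encodeSymbols rs) ≡
  encodeTape (shift (toMove d) (tape ls a rs))
shiftᶜ-correct 0             ls a rs = cong₂ (λ c b → pair c (pair b (encodeSymbols (a ∷ rs)))) (uncons-tl ls) (uncons-hd ls)
shiftᶜ-correct 1             ls a rs = refl
shiftᶜ-correct (suc (suc d)) ls a rs = cong₂ (λ b c → pair (encodeSymbols (a ∷ ls)) (pair b c)) (uncons-hd rs) (uncons-tl rs)

performᶜ : ℕ → ℕ → ℕ
performᶜ α T = shiftᶜ (π₁ (π₂ α)) (π₁ T) (ifz (π₁ α) 0 1) (π₂ (π₂ T))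

performᵖ : ∀ {n} → Prim n → Prim n → Prim n
performᵖ f g = call (restate
  (call
    (restate
      (ifzᵖ x₀ (pairᵖ (tlᵖ x₁) (pairᵖ (hdᵖ x₁) (consᵖ x₂ x₃)))
        (ifzᵖ (predᵖ x₀) (pairᵖ x₁ (pairᵖ x₂ x₃)) (pairᵖ (consᵖ x₂ x₁) (pairᵖ (hdᵖ x₃) (tlᵖ x₃)))))
      (λ { (d ∷ ls ∷ a ∷ rs ∷ []) → shiftᶜ d ls a rs }) (λ { (d ∷ ls ∷ a ∷ rs ∷ []) → refl }))
    (π₁ᵖ (π₂ᵖ x₀) ∷ π₁ᵖ x₁ ∷ ifzᵖ (π₁ᵖ x₀) (lit 0) (lit 1) ∷ π₂ᵖ (π₂ᵖ x₁) ∷ []))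
  (λ { (α ∷ T ∷ []) → performᶜ α T }) (λ { (α ∷ T ∷ []) → refl })) (f ∷ g ∷ [])

performᶜ-correct : ∀ α T → performᶜ α (encodeTape T) ≡
  encodeTape (shift (Action.move (toAction α)) (record T { scanned = Action.write (toAction α) }))
performᶜ-correct α (tape ls a rs)
  rewrite unpair-pair (encodeSymbols ls) (pair (encodeSymbol a) (encodeSymbols rs))
    | unpair-pair (encodeSymbol a) (encodeSymbols rs) =
  trans (cong (λ b → shiftᶜ (π₁ (π₂ α)) _ b _) (symbol (π₁ α))) (shiftᶜ-correct (π₁ (π₂ α)) ls _ rs)
  where
  symbol : ∀ b → ifz b 0 1 ≡ encodeSymbol (toSymbol b)
  symbol zero    = refl
  symbol (suc _) = refl

-- The tapes of a configuration, given by the list of their updates, latest first.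
Log : Set
Log = List (ℕ × Tape)

tapesOf : Log → ℕ → Tape
tapesOf []            = λ _ → blankTape
tapesOf ((t , S) ∷ l) = tapesOf l [ t ≔ S ]

encodeEntry : ℕ × Tape → ℕ
encodeEntry (t , S) = pair t (encodeTape S)

encodeLog : Log → ℕ
encodeLog = encodeList encodeEntry

-- A list headed by an entry for `i` is a fixed point, so surplus iterations are harmless. If there
-- is no entry, the list 0 is reached, from which `lookupᶜ` reads 0, the code of the blank tape.
find-step : ℕ → ℕ → ℕ
find-step i c = ifeq i (π₁ (hd c)) c (tl c)

lookupᶜ : ℕ → ℕ → ℕ
lookupᶜ i c = π₂ (hd (natrec c (λ _ → find-step i) c))

lookupᵖ : ∀ {n} → Prim n → Prim n → Prim n
lookupᵖ f g = call (restate
  (π₂ᵖ (hdᵖ (call (recursion x₁ (ifeqᵖ x₂ (π₁ᵖ (hdᵖ x₁)) x₁ (tlᵖ x₁))) (x₁ ∷ x₀ ∷ x₁ ∷ []))))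
  (λ { (i ∷ c ∷ []) → lookupᶜ i c }) (λ { (i ∷ c ∷ []) → refl })) (f ∷ g ∷ [])

lookupᶜ-correct : ∀ i l → lookupᶜ i (encodeLog l) ≡ encodeTape (tapesOf l i)
lookupᶜ-correct i l = go (encodeLog l) l (length≤encodeList encodeEntry l)
  where
  step-eq : ∀ t S l → find-step i (encodeLog ((t , S) ∷ l)) ≡ (if i ≡ᵇ t then encodeLog ((t , S) ∷ l) else encodeLog l)
  step-eq t S l
    rewrite unpair-pair (pair t (encodeTape S)) (encodeLog l) | unpair-pair t (encodeTape S) = ifeq-≡ᵇ i t _ _

  fixed-[] : find-step i 0 ≡ 0
  fixed-[] = trans (ifeq-≡ᵇ i 0 0 0) (both (i ≡ᵇ 0))
    where
    both : ∀ b → (if b then 0 else 0) ≡ 0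
    both true  = refl
    both false = refl

  go : ∀ k l → length l ≤ k → π₂ (hd (natrec (encodeLog l) (λ _ → find-step i) k)) ≡ encodeTape (tapesOf l i)
  go k [] _ rewrite natrec-fixed (find-step i) 0 fixed-[] k = refl
  go (suc k) ((t , S) ∷ l) (s≤s le)
    rewrite natrec-shift (find-step i) (encodeLog ((t , S) ∷ l)) k with i ≡ᵇ t | step-eq t S l
  ... | true  | eq rewrite eq | natrec-fixed (find-step i) _ eq k
    | unpair-pair (pair t (encodeTape S)) (encodeLog l) = π₂-pair t (encodeTape S)
  ... | false | eq rewrite eq = go k l le

-- Tapes as counters

data Counted : ℕ → List Symbol → Set where
  zero : ∀ {as} → All (_≡ blank) as → Counted 0 as
  suc  : ∀ {n as} → Counted n as → Counted (suc n) (one ∷ as)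

-- The head is at the leftmost one, so that a counter is decremented by a single action.
Represents : ℕ → Tape → Set
Represents n (tape ls a rs) = All (_≡ blank) ls × Counted n (a ∷ rs)

ones-blank : ∀ {as} → All (_≡ blank) as → ones as ≡ 0
ones-blank []          = refl
ones-blank (refl ∷ bs) = ones-blank bs

ones-counted : ∀ {n as} → Counted n as → ones as ≡ n
ones-counted (zero bs) = ones-blank bs
ones-counted (suc c)   = cong suc (ones-counted c)

value-represents : ∀ {n} S → Represents n S → value S ≡ n
value-represents (tape ls a rs) (bs , c) = cong₂ _+_ (ones-blank bs) (ones-counted c)

represents-unary : ∀ n → Represents n (unary n)
represents-unary zero    = [] , zero (refl ∷ [])
represents-unary (suc n) = [] , suc (counted n)
  where
  counted : ∀ n → Counted n (replicate n one)
  counted zero    = zero []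
  counted (suc n) = suc (counted n)

uncons-blank : ∀ {as} → All (_≡ blank) as → All (_≡ blank) (proj₂ (uncons as))
uncons-blank []       = []
uncons-blank (_ ∷ bs) = bs

uncons-counted : ∀ {n as} → Counted n as → Counted n (proj₁ (uncons as) ∷ proj₂ (uncons as))
uncons-counted {as = []}    (zero _) = zero (refl ∷ [])
uncons-counted {as = _ ∷ _} c        = c

increment : ∀ {n} S → Represents n S →
  Represents (suc n) (record (shift left S) { scanned = one })
increment (tape ls a rs) (bs , c) = uncons-blank bs , suc c

decrement : ∀ {n} S → Represents (suc n) S →
  Tape.scanned S ≡ one × Represents n (shift right (record S { scanned = blank }))
decrement (tape ls _ rs) (bs , suc c) = refl , (refl ∷ bs) , uncons-counted c

scanned-zero : ∀ S → Represents 0 S → Tape.scanned S ≡ blank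
scanned-zero (tape ls a rs) (_ , zero (eq ∷ _)) = eq

-- Tapes holding a stack of counters, with zeros above it

nth : List ℕ → ℕ → ℕ
nth []       _       = 0
nth (x ∷ xs) zero    = x
nth (x ∷ xs) (suc r) = nth xs r

infix 4 _⊨_
record _⊨_ (T : ℕ → Tape) (xs : List ℕ) : Set where
  constructor models
  field represents : ∀ r → Represents (nth xs r) (T r)
open _⊨_

-- Serves for reading as well as writing: `m` is the old entry and `n` the new one, arbitrary where
-- an entry is only read.
data Put : (r m n : ℕ) (xs ys : List ℕ) → Set where
  here  : ∀ {m n xs} → Put 0 m n (m ∷ xs) (n ∷ xs)
  there : ∀ {r m n x xs ys} → Put r m n xs ys → Put (suc r) m n (x ∷ xs) (x ∷ ys)

put : ∀ {r m n} zs {xs} → r ≡ length zs → Put r m n (zs ++ m ∷ xs) (zs ++ n ∷ xs)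
put []       refl = here
put (z ∷ zs) refl = there (put zs refl)

Put-++ : ∀ {r m n xs ys} zs → Put r m n xs ys → Put r m n (xs ++ zs) (ys ++ zs)
Put-++ zs here      = here
Put-++ zs (there p) = there (Put-++ zs p)

get : ∀ {r m n xs ys T} → Put r m n xs ys → T ⊨ xs → Represents m (T r)
get here      (models h) = h 0
get (there p) (models h) = get p (models (λ r → h (suc r)))

set : ∀ {r m n xs ys T S} → Put r m n xs ys → T ⊨ xs → Represents n S → T [ r ≔ S ] ⊨ ys
set here      (models h) s = models λ { zero → s ; (suc r) → h (suc r) }
set (there p) (models h) s = models λ { zero → h zero ; (suc r) → represents (set p (models (λ r → h (suc r))) s) r }

-- For `inc`: after its first action the head stands to the left of the ones, so the intermediate
-- tape `S` need not represent a counter.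
set-twice : ∀ {r m n xs ys T S S′} → Put r m n xs ys → T ⊨ xs → Represents n S′ → (T [ r ≔ S ]) [ r ≔ S′ ] ⊨ ys
set-twice here      (models h) s = models λ { zero → s ; (suc r) → h (suc r) }
set-twice (there p) (models h) s = models λ
  { zero → h zero ; (suc r) → represents (set-twice p (models (λ r → h (suc r))) s) r }

lookup-set : ∀ T t S → (T [ t ≔ S ]) t ≡ S
lookup-set T zero    S = refl
lookup-set T (suc t) S = lookup-set (λ i → T (suc i)) t S

-- Jumps and tests for zero rewrite a tape with its own contents, which leaves the tapes the same
-- only pointwise.
reset : ∀ {T xs} t {S} → S ≡ T t → T ⊨ xs → T [ t ≔ S ] ⊨ xs
reset {T} {xs} t refl (models h) = models at
  where
  at : ∀ r → Represents (nth xs r) ((T [ t ≔ T t ]) r)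
  at r with r ≡ᵇ t in eq
  ... | false = h r
  ... | true  = subst (λ i → Represents (nth xs r) (T i)) (≡ᵇ⇒≡ r t (subst Bool.T (sym eq) tt)) (h r)

nth-pad : ∀ xs r → nth (xs ∷ʳ 0) r ≡ nth xs r
nth-pad []       zero    = refl
nth-pad []       (suc r) = refl
nth-pad (x ∷ xs) zero    = refl
nth-pad (x ∷ xs) (suc r) = nth-pad xs r

-- All tapes above the stack represent 0, so a fresh counter is allocated, or an empty one released,
-- without executing anything.
pad : ∀ {T} xs → T ⊨ xs → T ⊨ xs ∷ʳ 0
pad {T} xs (models h) = models λ r → subst (λ n → Represents n (T r)) (sym (nth-pad xs r)) (h r)

unpad : ∀ {T} xs → T ⊨ xs ∷ʳ 0 → T ⊨ xs
unpad {T} xs (models h) = models λ r → subst (λ n → Represents n (T r)) (nth-pad xs r) (h r)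

-- Structured programs for counters

infixr 5 _⨾_
data Command : Set where
  skip   : Command
  inc    : (r : ℕ) → Command
  -- while r is positive, decrement it and execute the body
  loop   : (r : ℕ) → Command → Command
  oracle : (s t : ℕ) → Command
  _⨾_    : Command → Command → Command

end : Command → ℕ → ℕ
end skip         o = o
end (inc r)      o = 2 + o
end (loop r b)   o = suc (end b (suc o))
end (oracle s t) o = suc o
end (a ⨾ b)      o = end b (end a o)

goto : ℕ → Instruction
goto q = act 0 (action blank stay q) (action one stay q)

-- The positive branch also decrements: it erases the leftmost one and moves on to the next.
testZero : (r zeroTarget sucTarget : ℕ) → Instruction
testZero r q q′ = act r (action blank stay q) (action blank right q′)

code : Command → ℕ → List Instruction
code skip         o = []
-- An action writes before it moves, so moving left and then writing takes two instructions.
code (inc r)      o = act r (action blank left (1 + o)) (action one left (1 + o)) ∷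
                      act r (action one stay (2 + o)) (action one stay (2 + o)) ∷ []
code (loop r b)   o = testZero r (end (loop r b) o) (suc o) ∷ code b (suc o) ++ goto o ∷ []
code (oracle s t) o = oracle s t (suc o) ∷ []
code (a ⨾ b)      o = code a o ++ code b (end a o)

record Fetches (P : Program) (o : ℕ) (i : Instruction) : Set where
  constructor fetches
  field fetched : List.head (List.drop o P) ≡ just i

Occurs : Program → ℕ → List Instruction → Set
Occurs P o []       = ⊤
Occurs P o (i ∷ is) = Fetches P o i × Occurs P (suc o) is

occurs-++ˡ : ∀ {P o} is {js} → Occurs P o (is ++ js) → Occurs P o is
occurs-++ˡ []       _       = tt
occurs-++ˡ (i ∷ is) (h , t) = h , occurs-++ˡ is t

occurs-++ʳ : ∀ {P o} is {js} → Occurs P o (is ++ js) → Occurs P (length is + o) js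
occurs-++ʳ []       h       = h
occurs-++ʳ {P} {o} (i ∷ is) {js} (h , t) = subst (λ q → Occurs P q js) (+-suc (length is) o) (occurs-++ʳ is t)

length-∷ʳ : ∀ {A : Set} (xs : List A) {x} → length (xs ∷ʳ x) ≡ suc (length xs)
length-∷ʳ xs = trans (length-++ xs) (+-comm (length xs) 1)

end≡ : ∀ c o → length (code c o) + o ≡ end c o
end≡ skip         o = refl
end≡ (inc r)      o = refl
end≡ (loop r b)   o = cong suc (trans (cong (_+ o) (length-∷ʳ (code b (suc o))))
  (trans (sym (+-suc (length (code b (suc o))) o)) (end≡ b (suc o))))
end≡ (oracle s t) o = refl
end≡ (a ⨾ b)      o = trans (cong (_+ o) (trans (length-++ (code a o)) (+-comm (length (code a o)) _)))
  (trans (+-assoc (length (code b (end a o))) (length (code a o)) o)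
    (trans (cong (length (code b (end a o)) +_) (end≡ a o)) (end≡ b (end a o))))

occurs-after : ∀ {P o} c {js} → Occurs P o (code c o ++ js) → Occurs P (end c o) js
occurs-after {P} {o} c {js} h = subst (λ q → Occurs P q js) (end≡ c o) (occurs-++ʳ (code c o) h)

module _ (X : ℕ → ℕ) where

  Reach : Program → Config → Config → Set
  Reach P = Star (λ c c′ → status P X c ≡ moves c′)

  act-step : ∀ {P o t α β b d q} T → Fetches P o (act t α β) →
    choose (Tape.scanned (T t)) α β ≡ action b d q →
    status P X (config o T) ≡ moves (config q (T [ t ≔ shift d (record (T t) { scanned = b }) ]))
  act-step {t = t} T (fetches fetched) chosen =
    trans (cong (λ i → execute X i T) fetched) (cong (λ α → moves (perform α t T)) chosen)

  goto-step : ∀ {P o q} T {xs} → Fetches P o (goto q) → T ⊨ xs →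
    ∃[ T′ ] (status P X (config o T) ≡ moves (config q T′) × T′ ⊨ xs)
  goto-step {q = q} T fetched h = _ , act-step T fetched (keep (Tape.scanned (T 0))) , reset 0 refl h
    where
    keep : ∀ a → choose a (action blank stay q) (action one stay q) ≡ action a stay q
    keep blank = refl
    keep one   = refl

  zero-step : ∀ {P o r q q′ n xs ys} T → Fetches P o (testZero r q q′) → Put r 0 n xs ys → T ⊨ xs →
    ∃[ T′ ] (status P X (config o T) ≡ moves (config q T′) × T′ ⊨ xs)
  zero-step {r = r} T fetched p h =
    _ , act-step T fetched (cong (λ a → choose a _ _) blank≡) ,
    reset r (cong (λ a → record (T r) { scanned = a }) (sym blank≡)) h
    where blank≡ = scanned-zero (T r) (get p h)

  suc-step : ∀ {P o r q q′ n xs ys} T → Fetches P o (testZero r q q′) → Put r (suc n) n xs ys → T ⊨ xs →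
    ∃[ T′ ] (status P X (config o T) ≡ moves (config q′ T′) × T′ ⊨ ys)
  suc-step {r = r} T fetched p h =
    _ , act-step T fetched (cong (λ a → choose a _ _) (proj₁ d)) , set p h (proj₂ d)
    where d = decrement (T r) (get p h)

  -- Quantifying over all programs and addresses makes the statement independent of where the code
  -- is placed, so that it composes and a loop can return to its own start.
  record Computes (c : Command) (xs ys : List ℕ) : Set where
    constructor computes
    field run : ∀ {P o} T → Occurs P o (code c o) → T ⊨ xs →
                ∃[ T′ ] (Reach P (config o T) (config (end c o) T′) × T′ ⊨ ys)
  open Computes public

  infixr 5 _⟫_
  _⟫_ : ∀ {a b xs ys zs} → Computes a xs ys → Computes b ys zs → Computes (a ⨾ b) xs zs
  _⟫_ {a} f g = computes λ {_} {o} T at h →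
    let T₁ , R₁ , h₁ = run f T (occurs-++ˡ (code a o) at) h
        T₂ , R₂ , h₂ = run g T₁ (occurs-after a at) h₁
    in T₂ , R₁ ◅◅ R₂ , h₂

  padded : ∀ {c} xs {ys} → Computes c (xs ∷ʳ 0) ys → Computes c xs ys
  padded xs f = computes λ T at h → run f T at (pad xs h)

  unpadded : ∀ {c xs} ys → Computes c xs (ys ∷ʳ 0) → Computes c xs ys
  unpadded ys f = computes λ T at h → let T′ , R , h′ = run f T at h in T′ , R , unpad ys h′

  skip-computes : ∀ {xs} → Computes skip xs xs
  skip-computes = computes λ T _ h → T , ε , h

  inc-computes : ∀ {r n xs ys} → Put r n (suc n) xs ys → Computes (inc r) xs ys
  inc-computes {r} {n} p = computes λ {_} {o} T (fetched₁ , fetched₂ , _) h →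
    _ , act-step T fetched₁ (keep o (Tape.scanned (T r))) ◅ act-step (T₁ T) fetched₂ (same o (Tape.scanned (T₁ T r))) ◅ ε ,
    set-twice p h
      (subst (λ S → Represents (suc n) (record S { scanned = one })) (sym (lookup-set T r _)) (increment (T r) (get p h)))
    where
    T₁ : (ℕ → Tape) → ℕ → Tape
    T₁ T = T [ r ≔ shift left (T r) ]
    keep : ∀ o a → choose a (action blank left (1 + o)) (action one left (1 + o)) ≡ action a left (1 + o)
    keep o blank = refl
    keep o one   = refl
    same : ∀ o a → choose a (action one stay (2 + o)) (action one stay (2 + o)) ≡ action one stay (2 + o)
    same o blank = refl
    same o one   = refl

  oracle-computes : ∀ {s t a b m n xs xs′ ys} → Put s m n xs xs′ → Put t a b xs ys → b ≡ X m → Computes (oracle s t) xs ys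
  oracle-computes {s} {t} p p′ refl = computes λ T (fetches fetched , _) h → _ , cong (λ i → execute X i T) fetched ◅ ε ,
    set p′ h (subst (λ k → Represents (X k) (unary (X (value (T s)))))
      (value-represents (T s) (get p h)) (represents-unary _))

  loop-done : ∀ {r b n xs ys} → Put r 0 n xs ys → Computes (loop r b) xs xs
  loop-done p = computes λ T (fetched , _) h → let T′ , step , h′ = zero-step T fetched p h in T′ , step ◅ ε , h′

  loop-step : ∀ {r b n xs ys zs ws} → Put r (suc n) n xs ys → Computes b ys zs → Computes (loop r b) zs ws →
    Computes (loop r b) xs ws
  loop-step {b = b} p f g = computes λ {_} {o} T at@(fetched , at-body) h →
    let T₁ , step , h₁ = suc-step T fetched p h
        T₂ , R₂ , h₂ = run f T₁ (occurs-++ˡ (code b (suc o)) at-body) h₁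
        T₃ , back , h₃ = goto-step T₂ (proj₁ (occurs-after b at-body)) h₂
        T₄ , R₄ , h₄ = run g T₃ at h₃
    in T₄ , step ◅ R₂ ◅◅ back ◅ R₄ , h₄

-- Compilation of primitive recursive terms to counter commands

data Holds : List ℕ → ℕ → ℕ → Set where
  holds : ∀ pre {v post r} → r ≡ length pre → Holds (pre ++ v ∷ post) r v

length-append : ∀ {A : Set} (xs ys : List A) → length (xs ++ ys) ≡ length ys + length xs
length-append xs ys = trans (length-++ xs) (+-comm (length xs) (length ys))

weaken : ∀ {xs r v} ys → Holds xs r v → Holds (xs ++ ys) r v
weaken ys (holds pre {v} {post} eq) = subst (λ l → Holds l _ _) (sym (++-assoc pre (v ∷ post) ys)) (holds pre eq)

above : ∀ {xs ys r k v} → r ≡ length xs → Holds ys k v → Holds (xs ++ ys) (k + r) v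
above {xs} refl (holds pre {v} {post} refl) =
  subst (λ l → Holds l _ _) (++-assoc xs pre (v ∷ post)) (holds (xs ++ pre) (sym (length-append xs pre)))

put-above : ∀ {r k m n ys zs} xs → r ≡ length xs → Put k m n ys zs → Put (k + r) m n (xs ++ ys) (xs ++ zs)
put-above {k = k} {m} {n} {ys} {zs} [] refl p = subst (λ r → Put r m n ys zs) (sym (+-identityʳ k)) p
put-above {k = k} {m} {n} {ys} {zs} (x ∷ xs) refl p =
  subst (λ r → Put r m n (x ∷ xs ++ ys) (x ∷ xs ++ zs)) (sym (+-suc k (length xs))) (there (put-above xs refl p))

clear : ℕ → Command
clear r = loop r skip

-- Discards a temporary just below the top of the stack, the result above it taking its place.
nip : ℕ → Command
nip r = clear r ⨾ loop (suc r) (inc r)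

-- The upper entries go first, so that each `nip` finds the result directly above the entry to be
-- removed.
nips : (m r : ℕ) → Command
nips zero    r = skip
nips (suc m) r = nips m (suc r) ⨾ nip r

-- A counter is read only by draining it; hence it is drained into two counters, one of which
-- restores it.
copy : (r top : ℕ) → Command
copy r top = loop r (inc top ⨾ inc (suc top)) ⨾ loop (suc top) (inc r)

positions : (m top : ℕ) → Vec ℕ m
positions zero    top = []
positions (suc m) top = top ∷ positions m (suc top)

-- Pushes the value at the counters args; top is the height of the stack.
mutual
  compile : ∀ {n} → PR n → (args : Vec ℕ n) (top : ℕ) → Command
  compile zero        _          top = skip
  compile suc         (r ∷ [])   top = copy r top ⨾ inc top
  compile (proj i)    args       top = copy (Vec.lookup args i) top
  compile (comp {m} f gs) args   top =
    compileAll gs args top ⨾ compile f (positions m top) (m + top) ⨾ nips m top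
  -- Three entries are pushed: the remaining number of iterations, the index of the current one and
  -- the current value. The index gets its initial 0 from a counter that is skipped over.
  compile (rec f g)   (r ∷ args) top =
    copy r top ⨾ compile f args (2 + top) ⨾
    loop top (compile g (1 + top ∷ 2 + top ∷ args) (3 + top) ⨾ nip (2 + top) ⨾ inc (1 + top)) ⨾
    nip (1 + top) ⨾ nip top

  compileAll : ∀ {m n} → Vec (PR n) m → (args : Vec ℕ n) (top : ℕ) → Command
  compileAll []       args top = skip
  compileAll (g ∷ gs) args top = compile g args top ⨾ compileAll gs args (suc top)

module _ (X : ℕ → ℕ) where

  from : ∀ {c xs xs′ ys} → xs ≡ xs′ → Computes X c xs′ ys → Computes X c xs ys
  from refl f = f

  to : ∀ {c xs ys ys′} → ys ≡ ys′ → Computes X c xs ys → Computes X c xs ys′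
  to refl f = f

  clear-computes : ∀ {r} pre {post} n → r ≡ length pre → Computes X (clear r) (pre ++ n ∷ post) (pre ++ 0 ∷ post)
  clear-computes pre zero    eq = loop-done X (put {n = 0} pre eq)
  clear-computes pre (suc n) eq = loop-step X (put pre eq) (skip-computes X) (clear-computes pre n eq)

  nip-computes : ∀ {r} pre a b → r ≡ length pre → Computes X (nip r) (pre ++ a ∷ b ∷ []) (pre ∷ʳ b)
  nip-computes {r} pre a b eq = _⟫_ X (clear-computes pre a eq)
    (unpadded X (pre ∷ʳ b) (to (sym (++-assoc pre (b ∷ []) (0 ∷ []))) (go 0 b refl)))
    where
    go : ∀ a k → a + k ≡ b → Computes X (loop (suc r) (inc r)) (pre ++ a ∷ k ∷ []) (pre ++ b ∷ 0 ∷ [])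
    go a zero    e = to (cong (λ v → pre ++ v ∷ 0 ∷ []) (trans (sym (+-identityʳ a)) e))
      (loop-done X (put-above {n = 0} pre eq (there here)))
    go a (suc k) e = loop-step X (put-above pre eq (there here)) (inc-computes X (put pre eq))
      (go (suc a) k (trans (sym (+-suc a k)) e))

  nips-computes : ∀ {m top} xs (ys : Vec ℕ m) v → top ≡ length xs →
    Computes X (nips m top) ((xs ++ Vec.toList ys) ∷ʳ v) (xs ∷ʳ v)
  nips-computes xs []       v eq = from (++-assoc xs [] (v ∷ [])) (skip-computes X)
  nips-computes xs (y ∷ ys) v eq = _⟫_ X
    (from (cong (_∷ʳ v) (sym (++-assoc xs (y ∷ []) (Vec.toList ys))))
      (nips-computes (xs ∷ʳ y) ys v (trans (cong suc eq) (sym (length-∷ʳ xs)))))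
    (from (++-assoc xs (y ∷ []) (v ∷ [])) (nip-computes xs y v eq))

  copy-computes : ∀ {xs r v top} → Holds xs r v → top ≡ length xs → Computes X (copy r top) xs (xs ∷ʳ v)
  copy-computes {r = r} {v} {top} (holds pre {post = post} r≡) top≡ =
    padded X (pre ++ v ∷ post) (padded X ((pre ++ v ∷ post) ∷ʳ 0)
      (from (++-assoc (pre ++ v ∷ post) (0 ∷ []) (0 ∷ []))
        (_⟫_ X (there-and 0 v (+-identityʳ v))
          (unpadded X ((pre ++ v ∷ post) ∷ʳ v)
            (to (sym (++-assoc (pre ++ v ∷ post) (v ∷ []) (0 ∷ []))) (back 0 v refl))))))
    where
    height : ∀ n → top ≡ length (pre ++ n ∷ post)
    height n = trans top≡ (trans (length-++ pre) (sym (length-++ pre)))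

    there-and : ∀ k n → n + k ≡ v → Computes X (loop r (inc top ⨾ inc (suc top)))
      ((pre ++ n ∷ post) ++ k ∷ k ∷ []) ((pre ++ 0 ∷ post) ++ v ∷ v ∷ [])
    there-and k zero    refl = loop-done X (Put-++ _ (put {n = 0} pre r≡))
    there-and k (suc n) e = loop-step X (Put-++ _ (put pre r≡))
      (_⟫_ X (inc-computes X (put-above (pre ++ n ∷ post) (height n) here))
        (inc-computes X (put-above (pre ++ n ∷ post) (height n) (there here))))
      (there-and (suc k) n (trans (+-suc n k) e))

    back : ∀ n k → n + k ≡ v → Computes X (loop (suc top) (inc r))
      ((pre ++ n ∷ post) ++ v ∷ k ∷ []) ((pre ++ v ∷ post) ++ v ∷ 0 ∷ [])
    back n zero    e = to (cong (λ n → (pre ++ n ∷ post) ++ v ∷ 0 ∷ []) (trans (sym (+-identityʳ n)) e))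
      (loop-done X (put-above {n = 0} (pre ++ n ∷ post) (height n) (there here)))
    back n (suc k) e = loop-step X (put-above (pre ++ n ∷ post) (height n) (there here))
      (inc-computes X (Put-++ _ (put pre r≡)))
      (back (suc n) k (trans (sym (+-suc n k)) e))

  positions-hold : ∀ {m top} xs (ys : Vec ℕ m) → top ≡ length xs →
    Pointwise (Holds (xs ++ Vec.toList ys)) (positions m top) ys
  positions-hold xs []       eq = []
  positions-hold xs (y ∷ ys) eq = holds xs eq ∷
    subst (λ l → Pointwise (Holds l) _ ys) (++-assoc xs (y ∷ []) (Vec.toList ys))
      (positions-hold (xs ∷ʳ y) ys (trans (cong suc eq) (sym (length-∷ʳ xs))))

  mutual
    compile-computes : ∀ {n} (f : PR n) {xs top args vs} → top ≡ length xs → Pointwise (Holds xs) args vs →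
      Computes X (compile f args top) xs (xs ∷ʳ ⟦ f ⟧ vs)
    compile-computes zero {xs} eq _ = padded X xs (skip-computes X)
    compile-computes suc {xs} eq (h ∷ []) = _⟫_ X (copy-computes h eq) (inc-computes X (put xs eq))
    compile-computes (proj i) eq hs = copy-computes (Pointwise.lookup hs i) eq
    compile-computes (comp {m} f gs) {xs} {top} {vs = vs} eq hs =
      _⟫_ X (compileAll-computes gs eq hs) (_⟫_ X
        (compile-computes f (trans (cong (m +_) eq) (sym (height (⟦ gs ⟧* vs)))) (positions-hold xs (⟦ gs ⟧* vs) eq))
        (nips-computes xs (⟦ gs ⟧* vs) _ eq))
      where
      height : ∀ {m} (ys : Vec ℕ m) → length (xs ++ Vec.toList ys) ≡ m + length xs
      height {m} ys = trans (length-append xs (Vec.toList ys)) (cong (_+ length xs) (length-toList ys))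
    compile-computes (rec f g) {xs} {top} {args = r ∷ args} {vs = x ∷ vs} eq (h ∷ hs) =
      _⟫_ X (copy-computes h eq) (_⟫_ X
        (padded X (xs ∷ʳ x) (from (++-assoc xs (x ∷ []) (0 ∷ []))
          (to (++-assoc xs (x ∷ 0 ∷ []) _)
            (compile-computes f (trans (cong (2 +_) eq) (sym (length-append xs (x ∷ 0 ∷ []))))
              (Pointwise.map (weaken (x ∷ 0 ∷ [])) hs)))))
        (_⟫_ X (iterations x 0 (+-identityʳ x)) (_⟫_ X
          (from (sym (++-assoc xs (0 ∷ []) _)) (to (++-assoc xs (0 ∷ []) _)
            (nip-computes (xs ∷ʳ 0) x _ (trans (cong suc eq) (sym (length-∷ʳ xs))))))
          (nip-computes xs 0 _ eq))))
      where
      step : Command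
      step = compile g (1 + top ∷ 2 + top ∷ args) (3 + top) ⨾ nip (2 + top) ⨾ inc (1 + top)

      value-at : ℕ → ℕ
      value-at i = primrec f g i vs

      iteration : ∀ n i → Computes X step (xs ++ n ∷ i ∷ value-at i ∷ []) (xs ++ n ∷ suc i ∷ value-at (suc i) ∷ [])
      iteration n i = _⟫_ X
        (to (++-assoc xs (n ∷ i ∷ value-at i ∷ []) _)
          (compile-computes g (trans (cong (3 +_) eq) (sym (length-append xs (n ∷ i ∷ value-at i ∷ []))))
            (above eq (holds (n ∷ []) refl) ∷ above eq (holds (n ∷ i ∷ []) refl) ∷
             Pointwise.map (weaken (n ∷ i ∷ value-at i ∷ [])) hs)))
        (_⟫_ X
          (from (sym (++-assoc xs (n ∷ i ∷ []) _)) (to (++-assoc xs (n ∷ i ∷ []) _)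
            (nip-computes (xs ++ n ∷ i ∷ []) (value-at i) _ (trans (cong (2 +_) eq) (sym (length-append xs (n ∷ i ∷ [])))))))
          (inc-computes X (put-above xs eq (there here))))

      iterations : ∀ n i → n + i ≡ x → Computes X (loop top step)
        (xs ++ n ∷ i ∷ value-at i ∷ []) (xs ++ 0 ∷ x ∷ value-at x ∷ [])
      iterations zero    i refl = loop-done X (put {n = 0} xs eq)
      iterations (suc n) i e = loop-step X (put xs eq) (iteration n i) (iterations n (suc i) (trans (+-suc n i) e))

    compileAll-computes : ∀ {m n} (gs : Vec (PR n) m) {xs top args vs} → top ≡ length xs → Pointwise (Holds xs) args vs →
      Computes X (compileAll gs args top) xs (xs ++ Vec.toList (⟦ gs ⟧* vs))
    compileAll-computes []       {xs} eq hs = to (sym (++-identityʳ xs)) (skip-computes X)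
    compileAll-computes (g ∷ gs) {xs} eq hs = _⟫_ X (compile-computes g eq hs)
      (to (++-assoc xs _ _) (compileAll-computes gs (trans (cong suc eq) (sym (length-∷ʳ xs)))
        (Pointwise.map (weaken _) hs)))

-- Codes of programs

encodeMove : Move → ℕ
encodeMove left  = 0
encodeMove stay  = 1
encodeMove right = 2

encodeAction : Action → ℕ
encodeAction (action b d q) = pair (encodeSymbol b) (pair (encodeMove d) q)

opaque
  -- Opaque, as the codes of concrete instructions are closed numbers too large to evaluate.
  encodeInstruction : Instruction → ℕ
  encodeInstruction (act t α β)        = pair 0 (pair t (pair (encodeAction α) (encodeAction β)))
  encodeInstruction (oracle s t q)     = pair 1 (pair s (pair t q))
  encodeInstruction (query s s′ t q)   = pair 2 (pair s (pair s′ (pair t q)))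

toAction-encode : ∀ α → toAction (encodeAction α) ≡ α
toAction-encode (action b d q)
  rewrite unpair-pair (encodeSymbol b) (pair (encodeMove d) q) | unpair-pair (encodeMove d) q =
  cong₂ (λ b d → action b d q) (symbol b) (movement d)
  where
  symbol : ∀ b → toSymbol (encodeSymbol b) ≡ b
  symbol blank = refl
  symbol one   = refl
  movement : ∀ d → toMove (encodeMove d) ≡ d
  movement left  = refl
  movement stay  = refl
  movement right = refl

opaque
  unfolding encodeInstruction

  toInstruction-encode : ∀ i → toInstruction (encodeInstruction i) ≡ i
  toInstruction-encode (act t α β)
    rewrite unpair-pair 0 (pair t (pair (encodeAction α) (encodeAction β)))
      | unpair-pair t (pair (encodeAction α) (encodeAction β)) | unpair-pair (encodeAction α) (encodeAction β)
      | toAction-encode α | toAction-encode β = refl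
  toInstruction-encode (oracle s t q)
    rewrite unpair-pair 1 (pair s (pair t q)) | unpair-pair s (pair t q) | unpair-pair t q = refl
  toInstruction-encode (query s s′ t q)
    rewrite unpair-pair 2 (pair s (pair s′ (pair t q))) | unpair-pair s (pair s′ (pair t q))
      | unpair-pair s′ (pair t q) | unpair-pair t q = refl

encodeProgram : Program → ℕ
encodeProgram = encodeList encodeInstruction

program-encode : ∀ P → program (encodeProgram P) ≡ P
program-encode P = go (encodeProgram P) P ≤-refl
  where
  go : ∀ k P → encodeProgram P ≤ k → toProgram k (encodeProgram P) ≡ P
  go zero    []      _ = refl
  go (suc k) []      _ = refl
  go (suc k) (i ∷ P) (s≤s le) rewrite unpair-pair (encodeInstruction i) (encodeProgram P) =
    cong₂ _∷_ (toInstruction-encode i) (go k P (≤-trans (b≤pair (encodeInstruction i) _) le))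

constᵖ : ∀ {n} → ℕ → Prim n
constᵖ k = restate (lit k) (λ _ → k) (lit-fun k)

encodeActionᵖ : ∀ {n} → Symbol → Move → Prim n → Prim n
encodeActionᵖ b d q = pairᵖ (constᵖ (encodeSymbol b)) (pairᵖ (constᵖ (encodeMove d)) q)

encodeActᵖ : (t : ℕ) (b : Symbol) (d : Move) (b′ : Symbol) (d′ : Move) → Prim 2
encodeActᵖ t b d b′ d′ = pairᵖ (constᵖ 0) (pairᵖ (constᵖ t) (pairᵖ (encodeActionᵖ b d x₀) (encodeActionᵖ b′ d′ x₁)))

opaque
  unfolding encodeInstruction

  encodeActᵖ-fun : ∀ t b d b′ d′ q q′ →
    fun (encodeActᵖ t b d b′ d′) (q ∷ q′ ∷ []) ≡ encodeInstruction (act t (action b d q) (action b′ d′ q′))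
  encodeActᵖ-fun t b d b′ d′ q q′ = refl

actᵖ : ∀ {n} → ℕ → Symbol → Move → Symbol → Move → Prim n → Prim n
actᵖ t b d b′ d′ q = call (restate (encodeActᵖ t b d b′ d′)
  (λ { (q ∷ q′ ∷ []) → encodeInstruction (act t (action b d q) (action b′ d′ q′)) })
  (λ { (q ∷ q′ ∷ []) → encodeActᵖ-fun t b d b′ d′ q q′ })) (q ∷ q ∷ [])

gotoᵖ : ∀ {n} → Prim n → Prim n
gotoᵖ q = actᵖ 0 blank stay one stay q

prependᵖ : ∀ {n} → List Instruction → Prim n → Prim n
prependᵖ []       f = f
prependᵖ (i ∷ is) f = consᵖ (constᵖ (encodeInstruction i)) (prependᵖ is f)

prepend-fun : ∀ {n} is {js} (f : Prim n) xs → fun f xs ≡ encodeProgram js → fun (prependᵖ is f) xs ≡ encodeProgram (is ++ js)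
prepend-fun []       f xs eq = eq
prepend-fun (i ∷ is) f xs eq = cong (cons (encodeInstruction i)) (prepend-fun is f xs eq)

-- Suffixes of programs

drop-tail : ∀ {A : Set} o {xs : List A} {x ys} → List.drop o xs ≡ x ∷ ys → List.drop (suc o) xs ≡ ys
drop-tail zero    refl = refl
drop-tail (suc o) {_ ∷ xs} eq = drop-tail o eq

drop-++ : ∀ {P o} is {js : List Instruction} → List.drop o P ≡ is ++ js → List.drop (length is + o) P ≡ js
drop-++ []       eq = eq
drop-++ {P} {o} (i ∷ is) {js} eq =
  subst (λ q → List.drop q P ≡ js) (+-suc (length is) o) (drop-++ is (drop-tail o eq))

drop-code : ∀ {P o} c {js} → List.drop o P ≡ code c o ++ js → List.drop (end c o) P ≡ js
drop-code {P} {o} c {js} eq = subst (λ q → List.drop q P ≡ js) (end≡ c o) (drop-++ (code c o) eq)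

occurs : ∀ {P o} is {js} → List.drop o P ≡ is ++ js → Occurs P o is
occurs []       eq = tt
occurs {o = o} (i ∷ is) eq = fetches (cong List.head eq) , occurs is (drop-tail o eq)

-- Runs that halt, with their length

data Halting (P : Program) (X : ℕ → ℕ) (A : Answers) (v : ℕ) : ℕ → Config → Set where
  stop : ∀ {c} → status P X c ≡ halted v → Halting P X A v 0 c
  step : ∀ {k c c′} → Step P X A c c′ → Halting P X A v k c′ → Halting P X A v (suc k) c

halting : ∀ {P X A v c d} → Star (Step P X A) c d → status P X d ≡ halted v → ∃[ k ] Halting P X A v k c
halting ε       eq = 0 , stop eq
halting (s ◅ p) eq = let k , h = halting p eq in suc k , step s h

reach⇒steps : ∀ {P X A c c′} → Reach X P c c′ → Star (Step P X A) c c′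
reach⇒steps = Star.map compute

module _ {P : Program} {X : ℕ → ℕ} {A : Answers} {v : ℕ} where

  after-move : ∀ {k c c′} → status P X c ≡ moves c′ → Halting P X A v k c → ∃[ k′ ] (k′ < k × Halting P X A v k′ c′)
  after-move eq (stop eq′) with () ← trans (sym eq) eq′
  after-move eq (step (answer eq′ _) h) with () ← trans (sym eq) eq′
  after-move eq (step (compute eq′) h) with refl ← trans (sym eq) eq′ = _ , ≤-refl , h

  after-query : ∀ {k c e′ m′ resume} → status P X c ≡ asks e′ m′ resume → Halting P X A v k c →
    ∃[ k′ ] ∃[ a ] (k′ < k × A e′ m′ a × Halting P X A v k′ (resume a))
  after-query eq (stop eq′) with () ← trans (sym eq) eq′
  after-query eq (step (compute eq′) h) with () ← trans (sym eq) eq′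
  after-query eq (step (answer eq′ a) h) with refl ← trans (sym eq) eq′ = _ , _ , ≤-refl , a , h

  after-halt : ∀ {k c w} → status P X c ≡ halted w → Halting P X A v k c → w ≡ v
  after-halt eq (stop eq′) with refl ← trans (sym eq) eq′ = refl
  after-halt eq (step (compute eq′) h) with () ← trans (sym eq) eq′
  after-halt eq (step (answer eq′ _) h) with () ← trans (sym eq) eq′

  -- Moves are deterministic, so a halting run passes through every configuration reached by moves,
  -- and what is left of it is no longer than before.
  after-reach : ∀ {k c c′} → Reach X P c c′ → Halting P X A v k c → ∃[ k′ ] (k′ ≤ k × Halting P X A v k′ c′)
  after-reach ε        h = _ , ≤-refl , h
  after-reach (eq ◅ R) h =
    let _ , lt , h′ = after-move eq h
        k′ , le , h″ = after-reach R h′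
    in k′ , ≤-trans le (<⇒≤ lt) , h″

-- Realization of an abstract machine with numbers as states by a program

-- The counters when the interpreter with input x, run by the program for N, is in state R, and after
-- the examination of this state, which yields the argument b of the oracle, its value o, the query
-- (i , p) and the tag t.
stack : (x N R : ℕ) → List ℕ
stack x N R = x ∷ N ∷ R ∷ []

examined : (x N R b o i p t : ℕ) → List ℕ
examined x N R b o i p t = x ∷ N ∷ R ∷ b ∷ o ∷ i ∷ p ∷ t ∷ []

record Transitions : Set where
  field
    initialState    : (x N : ℕ) → ℕ
    arg tag out idx inp : ℕ → ℕ
    next            : (R o a : ℕ) → ℕ

module _ (M : Transitions) (X : ℕ → ℕ) (A : Answers) where
  open Transitions M

  data Transition (R : ℕ) : ℕ → Set where
    -- The answer 0 is what counter 7 holds once the tag 1 has been decremented by the first test.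
    move : tag R ≡ 1 → Transition R (next R (X (arg R)) 0)
    ask  : ∀ {k a} → tag R ≡ suc (suc k) → A (idx R) (inp R) a → Transition R (next R (X (arg R)) a)

  Output : ℕ → ℕ → Set
  Output R v = ∃[ R′ ] (Star Transition R R′ × tag R′ ≡ 0 × out R′ ≡ v)

module Control (start examine advance finish : Command) where

  writes : ℕ → Command
  writes zero    = skip
  writes (suc n) = inc 1 ⨾ writes n

  examineAt branchAt advanceAt finishAt exitAt : ℕ
  examineAt = end start 1
  branchAt  = end examine examineAt
  advanceAt = 3 + branchAt
  finishAt  = suc (end advance advanceAt)
  exitAt    = end finish finishAt

  -- The first address past the end of the program: entering it halts the machine.
  exit : ℕ → ℕ
  exit N = suc (end (writes N) (suc exitAt))

  tailFrom : ℕ → List Instruction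
  tailFrom N = goto (exit N) ∷ code (writes N) (suc exitAt) ++ goto 1 ∷ []

  -- Two decrementing tests separate the tags 0, 1 and larger ones; the answer to a query replaces
  -- what is left of the tag.
  branch : List Instruction
  branch = testZero 7 finishAt (1 + branchAt) ∷ testZero 7 advanceAt (2 + branchAt) ∷ query 5 6 7 advanceAt ∷ []

  -- The instructions writing `N` come last and are reached by a jump at entry. Thus everything
  -- before them is the same for all `N`, except for the target of the jump to the exit, and only
  -- this tail needs a recursion to be coded.
  machine : ℕ → Program
  machine N = goto (suc exitAt) ∷ code start 1 ++ code examine examineAt ++ branch ++
    code advance advanceAt ++ goto examineAt ∷ code finish finishAt ++ tailFrom N

  module Layout (N : ℕ) where
    P : Program
    P = machine N

    at-examine = drop-code {P} {1} start {code examine examineAt ++ branch ++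
      code advance advanceAt ++ goto examineAt ∷ code finish finishAt ++ tailFrom N} refl
    at-branch = drop-code {P} {examineAt} examine at-examine
    at-advance = drop-++ {P} {branchAt} branch at-branch
    at-back = drop-code {P} {advanceAt} advance at-advance
    at-finish = drop-tail (end advance advanceAt) {P} at-back
    at-exit = drop-code {P} {finishAt} finish at-finish
    at-writes = drop-tail exitAt {P} at-exit
    at-enter = drop-code {P} {suc exitAt} (writes N) at-writes
    at-end = drop-tail (end (writes N) (suc exitAt)) {P} at-enter

    entry-instruction : Fetches P 0 (goto (suc exitAt))
    entry-instruction = fetches refl
    start-occurs : Occurs P 1 (code start 1)
    start-occurs = occurs (code start 1) refl
    examine-occurs : Occurs P examineAt (code examine examineAt)
    examine-occurs = occurs (code examine examineAt) at-examine
    branch-occurs : Occurs P branchAt branch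
    branch-occurs = occurs branch at-branch
    advance-occurs : Occurs P advanceAt (code advance advanceAt)
    advance-occurs = occurs (code advance advanceAt) at-advance
    back-instruction : Fetches P (end advance advanceAt) (goto examineAt)
    back-instruction = fetches (cong List.head at-back)
    finish-occurs : Occurs P finishAt (code finish finishAt)
    finish-occurs = occurs (code finish finishAt) at-finish
    exit-instruction : Fetches P exitAt (goto (exit N))
    exit-instruction = fetches (cong List.head at-exit)
    writes-occurs : Occurs P (suc exitAt) (code (writes N) (suc exitAt))
    writes-occurs = occurs (code (writes N) (suc exitAt)) at-writes
    enter-instruction : Fetches P (end (writes N) (suc exitAt)) (goto 1)
    enter-instruction = fetches (cong List.head at-enter)

  writes-computes : ∀ X x n k → Computes X (writes n) (x ∷ k ∷ []) (x ∷ n + k ∷ [])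
  writes-computes X x zero    k = skip-computes X
  writes-computes X x (suc n) k = _⟫_ X (inc-computes X (there here))
    (to X (cong (λ v → x ∷ v ∷ []) (+-suc n k)) (writes-computes X x n (suc k)))

  end-writes : ∀ n o → end (writes n) o ≡ n + n + o
  end-writes zero    o = refl
  end-writes (suc n) o = trans (end-writes n (2 + o)) (trans (+-suc (n + n) (suc o))
    (cong suc (trans (+-suc (n + n) o) (cong (_+ o) (sym (+-suc n n))))))

  exitᵖ : Prim 1
  exitᵖ = restate (sucᵖ (x₀ +ᵖ x₀ +ᵖ constᵖ (suc exitAt))) (λ { (N ∷ []) → exit N })
    (λ { (N ∷ []) → cong suc (sym (end-writes N (suc exitAt))) })

  -- The instructions are listed from the end, so that those writing the last j ones of N start at
  -- the address below.
  address : (N j : ℕ) → ℕ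
  address N j = suc exitAt + ((N ∸ j) + (N ∸ j))

  address-suc : ∀ {N j} → j < N → address N j ≡ 2 + address N (suc j)
  address-suc {N} {j} j<N = trans (cong (λ d → suc exitAt + (d + d)) (∸-suc j<N))
    (trans (cong (suc exitAt +_) (cong suc (+-suc d d)))
      (trans (+-suc (suc exitAt) (suc (d + d))) (cong suc (+-suc (suc exitAt) (d + d)))))
    where
    d = N ∸ suc j
    ∸-suc : ∀ {j N} → j < N → N ∸ j ≡ suc (N ∸ suc j)
    ∸-suc {zero}  {suc N} _         = refl
    ∸-suc {suc j} {suc N} (s≤s j<N) = ∸-suc j<N

  writesᵖ : Prim 1
  writesᵖ = restate
    (call (recursion (prependᵖ (goto 1 ∷ []) (constᵖ 0))
        (consᵖ (actᵖ 1 blank left one left (sucᵖ o))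
          (consᵖ (actᵖ 1 one stay one stay (sucᵖ (sucᵖ o))) x₁)))
      -- `N` is the number of iterations and also the parameter from which the absolute addresses
      -- are computed.
      (x₀ ∷ x₀ ∷ []))
    (λ { (N ∷ []) → encodeProgram (code (writes N) (suc exitAt) ++ goto 1 ∷ []) })
    (λ { (N ∷ []) → trans (agrees N N ≤-refl) (cong (λ o → encodeProgram (code (writes N) o ++ goto 1 ∷ [])) (last N)) })
    where
    o : Prim 3
    o = constᵖ (suc exitAt) +ᵖ ((x₂ ∸ᵖ sucᵖ x₀) +ᵖ (x₂ ∸ᵖ sucᵖ x₀))

    last : ∀ N → address N N ≡ suc exitAt
    last N = trans (cong (λ d → suc exitAt + (d + d)) (n∸n≡0 N)) (+-identityʳ (suc exitAt))

    write : (o r : ℕ) → ℕ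
    write o r =
      cons (encodeInstruction (act 1 (action blank left (1 + o)) (action one left (1 + o))))
        (cons (encodeInstruction (act 1 (action one stay (2 + o)) (action one stay (2 + o)))) r)

    agrees : ∀ N j → j ≤ N →
      natrec (encodeProgram (goto 1 ∷ [])) (λ j → write (address N (suc j))) j
      ≡ encodeProgram (code (writes j) (address N j) ++ goto 1 ∷ [])
    agrees N zero    _   = refl
    agrees N (suc j) j<N = cong (write (address N (suc j)))
      (trans (agrees N j (<⇒≤ j<N)) (cong (λ o → encodeProgram (code (writes j) o ++ goto 1 ∷ [])) (address-suc j<N)))

  machineᵖ : Prim 1
  machineᵖ = restate (prependᵖ (goto (suc exitAt) ∷ []) p₁) (λ { (N ∷ []) → encodeProgram (machine N) })
    (λ { xs@(N ∷ []) → prepend-fun (goto (suc exitAt) ∷ []) p₁ xs (prepend-fun (code start 1) p₂ xs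
      (prepend-fun (code examine examineAt) p₃ xs (prepend-fun branch p₄ xs
        (prepend-fun (code advance advanceAt) p₅ xs (prepend-fun (goto examineAt ∷ code finish finishAt) p₆ xs refl))))) })
    where
    p₁ p₂ p₃ p₄ p₅ p₆ : Prim 1
    p₁ = prependᵖ (code start 1) p₂
    p₂ = prependᵖ (code examine examineAt) p₃
    p₃ = prependᵖ branch p₄
    p₄ = prependᵖ (code advance advanceAt) p₅
    p₅ = prependᵖ (goto examineAt ∷ code finish finishAt) p₆
    p₆ = consᵖ (gotoᵖ exitᵖ) writesᵖ

  record Implementation (X : ℕ → ℕ) (x N : ℕ) (M : Transitions) : Set where
    open Transitions M

    full : ℕ → ℕ → List ℕ
    full R t = examined x N R (arg R) (X (arg R)) (idx R) (inp R) t

    field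
      start-computes   : Computes X start (x ∷ N ∷ []) (stack x N (initialState x N))
      examine-computes : ∀ R → Computes X examine (stack x N R) (full R (tag R))
      advance-computes : ∀ R a → Computes X advance (full R a) (stack x N (next R (X (arg R)) a))
      finish-computes  : ∀ R → Computes X finish (full R 0) (out R ∷ [])

  module Run (X : ℕ → ℕ) (x N : ℕ) (M : Transitions) (implementation : Implementation X x N M) where
    open Transitions M
    open Implementation implementation
    open Layout N

    at-7 : ∀ {R t t′} → Put 7 t t′ (full R t) (full R t′)
    at-7 = there (there (there (there (there (there (there here))))))

    start-reach : ∃[ T ] (Reach X P (initial x) (config examineAt T) × T ⊨ stack x N (initialState x N))
    start-reach =
      let T₁ , s₁ , h₁ = goto-step X _ entry-instruction initial-represents
          T₂ , R₂ , h₂ = run (padded X (x ∷ []) (to X (cong (λ n → x ∷ n ∷ []) (+-identityʳ N)) (writes-computes X x N 0)))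
                           T₁ writes-occurs h₁
          T₃ , s₃ , h₃ = goto-step X T₂ enter-instruction h₂
          T₄ , R₄ , h₄ = run start-computes T₃ start-occurs h₃
      in T₄ , s₁ ◅ R₂ ◅◅ s₃ ◅ R₄ , h₄
      where
      initial-represents : ((λ _ → blankTape) [ 0 ≔ unary x ]) ⊨ x ∷ []
      initial-represents = models λ { zero → represents-unary x ; (suc r) → represents-unary 0 }

    module _ {T : ℕ → Tape} {R : ℕ} (h : T ⊨ stack x N R) where

      halt-reach : tag R ≡ 0 →
        ∃[ T′ ] (Reach X P (config examineAt T) (config (exit N) T′) × status P X (config (exit N) T′) ≡ halted (out R))
      halt-reach tag≡ =
        let T₁ , R₁ , h₁ = run (examine-computes R) T examine-occurs h
            T₂ , s₂ , h₂ = zero-step X T₁ (proj₁ branch-occurs) (at-7 {R} {t′ = 0}) (subst (λ t → T₁ ⊨ full R t) tag≡ h₁)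
            T₃ , R₃ , h₃ = run (finish-computes R) T₂ finish-occurs h₂
            T₄ , s₄ , h₄ = goto-step X T₃ exit-instruction h₃
        in T₄ , R₁ ◅◅ s₂ ◅ R₃ ◅◅ s₄ ◅ ε ,
           trans (cong (λ is → execute X (List.head is) T₄) at-end) (cong halted (value-represents (T₄ 0) (represents h₄ 0)))

      private
        advance-reach : ∀ {T} a → T ⊨ full R a →
          ∃[ T′ ] (Reach X P (config advanceAt T) (config examineAt T′) × T′ ⊨ stack x N (next R (X (arg R)) a))
        advance-reach a h =
          let T₁ , R₁ , h₁ = run (advance-computes R a) _ advance-occurs h
              T₂ , s₂ , h₂ = goto-step X T₁ back-instruction h₁
          in T₂ , R₁ ◅◅ s₂ ◅ ε , h₂

      -- The first step is split off to show that the run gets shorter.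
      move-reach : tag R ≡ 1 → ∃[ T′ ] ∃[ c ] ∃[ c′ ] (Reach X P (config examineAt T) c × status P X c ≡ moves c′ ×
        Reach X P c′ (config examineAt T′) × T′ ⊨ stack x N (next R (X (arg R)) 0))
      move-reach tag≡ =
        let T₁ , R₁ , h₁ = run (examine-computes R) T examine-occurs h
            T₂ , s₂ , h₂ = suc-step X T₁ (proj₁ branch-occurs) (at-7 {R} {t′ = 0}) (subst (λ t → T₁ ⊨ full R t) tag≡ h₁)
            T₃ , s₃ , h₃ = zero-step X T₂ (proj₁ (proj₂ branch-occurs)) (at-7 {R} {t′ = 0}) h₂
            T₄ , R₄ , h₄ = advance-reach 0 h₃
        in T₄ , _ , _ , R₁ , s₂ , s₃ ◅ R₄ , h₄

      query-reach : ∀ {k} → tag R ≡ suc (suc k) →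
        ∃[ c ] ∃[ resume ] (Reach X P (config examineAt T) c × status P X c ≡ asks (idx R) (inp R) resume ×
          ∀ a → ∃[ T′ ] (Reach X P (resume a) (config examineAt T′) × T′ ⊨ stack x N (next R (X (arg R)) a)))
      query-reach {k} tag≡ =
        let T₁ , R₁ , h₁ = run (examine-computes R) T examine-occurs h
            T₂ , s₂ , h₂ = suc-step X T₁ (proj₁ branch-occurs) (at-7 {R} {t′ = suc k}) (subst (λ t → T₁ ⊨ full R t) tag≡ h₁)
            T₃ , s₃ , h₃ = suc-step X T₂ (proj₁ (proj₂ branch-occurs)) (at-7 {R} {t′ = k}) h₂
        in config (2 + branchAt) T₃ , (λ a → config advanceAt (T₃ [ 7 ≔ unary a ])) , R₁ ◅◅ s₂ ◅ s₃ ◅ ε ,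
           trans (cong (λ i → execute X i T₃) (Fetches.fetched (proj₁ (proj₂ (proj₂ branch-occurs)))))
             (cong₂ (λ i p → asks i p (λ a → config advanceAt (T₃ [ 7 ≔ unary a ])))
               (value-represents (T₃ 5) (represents h₃ 5)) (value-represents (T₃ 6) (represents h₃ 6))) ,
           λ a → advance-reach a (set (at-7 {R} {k}) h₃ (represents-unary a))

    machine-complete : ∀ {A v} → Output M X A (initialState x N) v → HaltsWith P X A x v
    machine-complete {A} {v} (_ , p , tag≡ , out≡) =
      let _ , R , h = start-reach
          c , q , eq = go p tag≡ out≡ h
      in c , reach⇒steps R ◅◅ q , eq
      where
      go : ∀ {T R R′} → Star (Transition M X A) R R′ → tag R′ ≡ 0 → out R′ ≡ v → T ⊨ stack x N R →
        ∃[ c ] (Star (Step P X A) (config examineAt T) c × status P X c ≡ halted v)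
      go ε tag≡ refl h = let _ , R , eq = halt-reach h tag≡ in _ , reach⇒steps R , eq
      go (move m ◅ p) tag≡ out≡ h =
        let _ , _ , _ , R₁ , s , R₂ , h′ = move-reach h m
            c , q , eq = go p tag≡ out≡ h′
        in c , reach⇒steps (R₁ ◅◅ s ◅ R₂) ◅◅ q , eq
      go (ask k a ◅ p) tag≡ out≡ h =
        let _ , _ , R₁ , s , f = query-reach h k
            _ , R₂ , h′ = f _
            c , q , eq = go p tag≡ out≡ h′
        in c , reach⇒steps R₁ ◅◅ answer s a ◅ reach⇒steps R₂ ◅◅ q , eq

    -- By induction on the length of the halting run, with `f` as a bound: determinism cuts the run
    -- at successive visits to `examineAt`, and every round contains a test that takes at least one
    -- step.
    machine-sound : ∀ {A v} → HaltsWith P X A x v → Output M X A (initialState x N) v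
    machine-sound {A} {v} (_ , p , eq) =
      let _ , R , h = start-reach
          _ , H = halting p eq
          _ , _ , H′ = after-reach R H
      in go _ ≤-refl H′ h
      where
      go : ∀ f {k T R} → k < f → Halting P X A v k (config examineAt T) → T ⊨ stack x N R → Output M X A R v
      by-tag : ∀ f {k T R} → k ≤ f → Halting P X A v k (config examineAt T) → T ⊨ stack x N R →
        ∀ t → tag R ≡ t → Output M X A R v
      go (suc f) (s≤s le) H h = by-tag f le H h _ refl
      by-tag f le H h 0 tag≡ =
        let _ , R , eq = halt-reach h tag≡
            _ , _ , H′ = after-reach R H
        in _ , ε , tag≡ , after-halt eq H′
      by-tag f le H h 1 tag≡ =
        let _ , _ , _ , R₁ , s , R₂ , h′ = move-reach h tag≡
            _ , le₁ , H₁ = after-reach R₁ H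
            _ , lt₂ , H₂ = after-move s H₁
            _ , le₃ , H₃ = after-reach R₂ H₂
            R′ , p , done = go f (≤-trans (s≤s le₃) (≤-trans lt₂ (≤-trans le₁ le))) H₃ h′
        in R′ , move tag≡ ◅ p , done
      by-tag f le H h (suc (suc _)) tag≡ =
        let _ , _ , R₁ , s , resumed = query-reach h tag≡
            _ , le₁ , H₁ = after-reach R₁ H
            _ , a , lt₂ , α , H₂ = after-query s H₁
            _ , R₂ , h′ = resumed a
            _ , le₃ , H₃ = after-reach R₂ H₂
            R′ , p , done = go f (≤-trans (s≤s le₃) (≤-trans lt₂ (≤-trans le₁ le))) H₃ h′
        in R′ , ask tag≡ α ◅ p , done

module Machine (initialᵖ : Prim 2) (argumentᵖ tagᵖ outputᵖ indexᵖ inputᵖ : Prim 1) (nextᵖ : Prim 3) where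

  push : ∀ {n} → Prim n → Vec ℕ n → ℕ → Command
  push f = compile (term f)

  push-computes : ∀ X {n} (f : Prim n) {xs top args vs} → top ≡ length xs → Pointwise (Holds xs) args vs →
    Computes X (push f args top) xs (xs ∷ʳ fun f vs)
  push-computes X f {xs} {vs = vs} eq hs = to X (cong (xs ∷ʳ_) (correct f vs)) (compile-computes X (term f) eq hs)

  start examine advance finish : Command
  start   = push initialᵖ (0 ∷ 1 ∷ []) 2
  examine = push argumentᵖ (2 ∷ []) 3 ⨾ oracle 3 4 ⨾
    push indexᵖ (2 ∷ []) 5 ⨾ push inputᵖ (2 ∷ []) 6 ⨾ push tagᵖ (2 ∷ []) 7
  -- Counters 2, 4 and 7 hold the state, the oracle value and the answer; the new state, pushed at
  -- 8, sinks to 2 as the six entries below it are dropped.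
  advance = push nextᵖ (2 ∷ 4 ∷ 7 ∷ []) 8 ⨾ nips 6 2
  finish  = push outputᵖ (2 ∷ []) 8 ⨾ nips 8 0

  M : Transitions
  M = record
    { initialState = λ x N → fun initialᵖ (x ∷ N ∷ [])
    ; arg = λ R → fun argumentᵖ (R ∷ [])
    ; tag = λ R → fun tagᵖ (R ∷ [])
    ; out = λ R → fun outputᵖ (R ∷ [])
    ; idx = λ R → fun indexᵖ (R ∷ [])
    ; inp = λ R → fun inputᵖ (R ∷ [])
    ; next = λ R o a → fun nextᵖ (R ∷ o ∷ a ∷ [])
    }
  open Transitions M

  module _ (X : ℕ → ℕ) (x N : ℕ) where
    full : ℕ → ℕ → List ℕ
    full R t = examined x N R (arg R) (X (arg R)) (idx R) (inp R) t

    state-at-2 : ∀ {R ys} → Holds (x ∷ N ∷ R ∷ ys) 2 R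
    state-at-2 = holds (x ∷ N ∷ []) refl

    start-computes : Computes X start (x ∷ N ∷ []) (stack x N (initialState x N))
    start-computes = push-computes X initialᵖ refl (holds [] refl ∷ holds (x ∷ []) refl ∷ [])

    examine-computes : ∀ R → Computes X examine (stack x N R) (full R (tag R))
    examine-computes R = _⟫_ X (push-computes X argumentᵖ refl (state-at-2 ∷ [])) (_⟫_ X
      (padded X (x ∷ N ∷ R ∷ arg R ∷ [])
        (oracle-computes X {n = 0} (there (there (there here))) (there (there (there (there here)))) refl))
      (_⟫_ X (push-computes X indexᵖ refl (state-at-2 ∷ [])) (_⟫_ X (push-computes X inputᵖ refl (state-at-2 ∷ []))
        (push-computes X tagᵖ refl (state-at-2 ∷ [])))))

    advance-computes : ∀ R a → Computes X advance (full R a) (stack x N (next R (X (arg R)) a))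
    advance-computes R a = _⟫_ X
      (push-computes X nextᵖ refl (state-at-2 ∷ holds (x ∷ N ∷ R ∷ arg R ∷ []) refl ∷
        holds (x ∷ N ∷ R ∷ arg R ∷ X (arg R) ∷ idx R ∷ inp R ∷ []) refl ∷ []))
      (nips-computes X (x ∷ N ∷ []) (R ∷ arg R ∷ X (arg R) ∷ idx R ∷ inp R ∷ a ∷ []) _ refl)

    finish-computes : ∀ R → Computes X finish (full R 0) (out R ∷ [])
    finish-computes R = _⟫_ X (push-computes X outputᵖ refl (state-at-2 ∷ []))
      (nips-computes X [] (x ∷ N ∷ R ∷ arg R ∷ X (arg R) ∷ idx R ∷ inp R ∷ 0 ∷ []) _ refl)

    implementation : Control.Implementation start examine advance finish X x N M
    implementation = record
      { start-computes   = start-computes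
      ; examine-computes = examine-computes
      ; advance-computes = advance-computes
      ; finish-computes  = finish-computes
      }

  machine : ℕ → Program
  machine = Control.machine start examine advance finish

  machineᵖ : Prim 1
  machineᵖ = Control.machineᵖ start examine advance finish

  complete : ∀ {X A} x N {v} → Output M X A (initialState x N) v → HaltsWith (machine N) X A x v
  complete {X} x N = Control.Run.machine-complete start examine advance finish X x N M (implementation X x N)

  sound : ∀ {X A} x N {v} → HaltsWith (machine N) X A x v → Output M X A (initialState x N) v
  sound {X} x N = Control.Run.machine-sound start examine advance finish X x N M (implementation X x N)

-- One step of the simulated machine as a primitive recursive function

-- 0, 1 and 2 stand for a halted machine, a computation step and a query.
kind : ℕ → ℕ
kind c = ifz c 0 (ifz (pred (π₁ (hd c))) 1 2)

kindᵖ : ∀ {n} → Prim n → Prim n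
kindᵖ f = call (restate (ifzᵖ x₀ (lit 0) (ifzᵖ (predᵖ (π₁ᵖ (hdᵖ x₀))) (lit 1) (lit 2)))
  (λ { (c ∷ []) → kind c }) (λ { (c ∷ []) → refl })) (f ∷ [])

body : ℕ → ℕ
body c = π₂ (hd c)

bodyᵖ : ∀ {n} → Prim n → Prim n
bodyᵖ f = π₂ᵖ (hdᵖ f)

actBy : (scanned b T : ℕ) → ℕ
actBy scanned b T = pair (π₂ (π₂ α)) (pair (π₁ b) (performᶜ α T))
  where α = ifz scanned (π₁ (π₂ b)) (π₂ (π₂ b))

actUpdate : ℕ → ℕ → ℕ
actUpdate b l = actBy (π₁ (π₂ T)) b T
  where T = lookupᶜ (π₁ b) l

-- The code of (q , (t , S)), where q is the next state and S the new contents of tape t, when the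
-- instruction coded by c is executed on the tapes coded by l; o is the value of the oracle and a
-- the answer to the query.
updateBy : (tag b l o a : ℕ) → ℕ
updateBy tag b l o a = ifz tag (actUpdate b l)
  (ifz (pred tag)
    (pair (π₂ (π₂ b)) (pair (π₁ (π₂ b)) (unaryᶜ o)))
    (pair (π₂ (π₂ (π₂ b))) (pair (π₁ (π₂ (π₂ b))) (unaryᶜ a))))

update : ℕ → ℕ → ℕ → ℕ → ℕ
update c l o a = updateBy (π₁ (hd c)) (body c) l o a

updateᵖ : Prim 4
updateᵖ = restate
  (ifzᵖ (π₁ᵖ (hdᵖ x₀)) (actUpdateᵖ b x₁)
    (ifzᵖ (predᵖ (π₁ᵖ (hdᵖ x₀)))
      (pairᵖ (π₂ᵖ (π₂ᵖ b)) (pairᵖ (π₁ᵖ (π₂ᵖ b)) (unaryᵖ x₂)))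
      (pairᵖ (π₂ᵖ (π₂ᵖ (π₂ᵖ b))) (pairᵖ (π₁ᵖ (π₂ᵖ (π₂ᵖ b))) (unaryᵖ x₃)))))
  (λ { (c ∷ l ∷ o ∷ a ∷ []) → update c l o a }) (λ { (c ∷ l ∷ o ∷ a ∷ []) → refl })
  where
  b : Prim 4
  b = bodyᵖ x₀

  T α : Prim 2
  T = lookupᵖ (π₁ᵖ x₀) x₁
  α = ifzᵖ (π₁ᵖ (π₂ᵖ T)) (π₁ᵖ (π₂ᵖ x₀)) (π₂ᵖ (π₂ᵖ x₀))

  actUpdateᵖ : Prim 4 → Prim 4 → Prim 4
  actUpdateᵖ f g = call (restate (pairᵖ (π₂ᵖ (π₂ᵖ α)) (pairᵖ (π₁ᵖ x₀) (performᵖ α T)))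
    (λ { (b ∷ l ∷ []) → actUpdate b l }) (λ { (b ∷ l ∷ []) → refl })) (f ∷ g ∷ [])

-- The state of the interpreter consists of the index u of the program to be asked in place of
-- simulated queries, the index e of the simulated program, its state q, the log l of its tapes, and
-- a fuel f, where 0 means unlimited fuel and suc k that k more steps may be simulated.
opaque
  encodeState : (u e f q : ℕ) → Log → ℕ
  encodeState u e f q l = pair u (pair e (pair f (pair q (encodeLog l))))

fields : ℕ → Vec ℕ 5
fields R = π₁ R ∷ π₁ (π₂ R) ∷ π₁ (π₂ (π₂ R)) ∷ π₁ (π₂ (π₂ (π₂ R))) ∷ π₂ (π₂ (π₂ (π₂ R))) ∷ []

opaque
  unfolding encodeState

  fields-encodeState : ∀ u e f q l → fields (encodeState u e f q l) ≡ u ∷ e ∷ f ∷ q ∷ encodeLog l ∷ []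
  fields-encodeState u e f q l
    rewrite unpair-pair u (pair e (pair f (pair q (encodeLog l)))) | unpair-pair e (pair f (pair q (encodeLog l)))
      | unpair-pair f (pair q (encodeLog l)) | unpair-pair q (encodeLog l) = refl

-- Fuel 1 forces the tag 0, so that the interpreter halts even if the simulated machine does not.
-- Each step takes `pred` of the fuel, which leaves the unlimited fuel 0 unchanged.
limited : ℕ → ℕ → ℕ
limited f k = ifz f k (ifz (pred f) 0 k)

output : ℕ → ℕ → ℕ → ℕ
output f k v = ifz f v (ifz k 0 1)

operand : ℕ → ℕ → ℕ
operand t l = valueᶜ (lookupᶜ t l)

operandᵖ : ∀ {n} → Prim n → Prim n → Prim n
operandᵖ f g = valueᵖ (lookupᵖ f g)

assembleᵖ : Prim 7
assembleᵖ = call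
  (restate (pairᵖ x₁ (pairᵖ x₂ (pairᵖ (predᵖ x₃) (pairᵖ (π₁ᵖ x₀) (consᵖ (π₂ᵖ x₀) x₄)))))
    (λ { (U ∷ u ∷ e ∷ f ∷ l ∷ []) → pair u (pair e (pair (pred f) (pair (π₁ U) (cons (π₂ U) l)))) })
    (λ { (U ∷ u ∷ e ∷ f ∷ l ∷ []) → refl }))
  (call updateᵖ (fetchᵖ x₁ x₃ ∷ x₄ ∷ x₅ ∷ x₆ ∷ []) ∷ x₀ ∷ x₁ ∷ x₂ ∷ x₄ ∷ [])

opaque
  successorState : (u e f q l o a : ℕ) → ℕ
  successorState u e f q l o a = pair u (pair e (pair (pred f) (pair (π₁ U) (cons (π₂ U) l))))
    where
    U : ℕ
    U = update (fetch e q) l o a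

  assemble-correct : ∀ u e f q l o a →
    fun assembleᵖ (u ∷ e ∷ f ∷ q ∷ l ∷ o ∷ a ∷ []) ≡ successorState u e f q l o a
  assemble-correct u e f q l o a = refl

successorStateᵖ : Prim 7
successorStateᵖ = restate assembleᵖ (λ { (u ∷ e ∷ f ∷ q ∷ l ∷ o ∷ a ∷ []) → successorState u e f q l o a })
  (λ { (u ∷ e ∷ f ∷ q ∷ l ∷ o ∷ a ∷ []) → assemble-correct u e f q l o a })

fieldsᵖ : ∀ {n} → Vec (Prim (suc n)) 5
fieldsᵖ = π₁ᵖ x₀ ∷ π₁ᵖ (π₂ᵖ x₀) ∷ π₁ᵖ (π₂ᵖ (π₂ᵖ x₀)) ∷ π₁ᵖ (π₂ᵖ (π₂ᵖ (π₂ᵖ x₀))) ∷ π₂ᵖ (π₂ᵖ (π₂ᵖ (π₂ᵖ x₀))) ∷ []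

tagOf outputOf argumentOf indexOf inputOf : Vec ℕ 5 → ℕ
tagOf      (u ∷ e ∷ f ∷ q ∷ l ∷ []) = limited f (kind (fetch e q))
outputOf   (u ∷ e ∷ f ∷ q ∷ l ∷ []) = output f (kind (fetch e q)) (operand 0 l)
argumentOf (u ∷ e ∷ f ∷ q ∷ l ∷ []) = operand (π₁ (body (fetch e q))) l
indexOf    (u ∷ e ∷ f ∷ q ∷ l ∷ []) = u
inputOf    (u ∷ e ∷ f ∷ q ∷ l ∷ []) =
  pair u (pair (operand (π₁ (body (fetch e q))) l) (operand (π₁ (π₂ (body (fetch e q)))) l))

nextOf : Vec ℕ 5 → ℕ → ℕ → ℕ
nextOf (u ∷ e ∷ f ∷ q ∷ l ∷ []) o a = successorState u e f q l o a

operand-correct : ∀ t l → operand t (encodeLog l) ≡ value (tapesOf l t)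
operand-correct t l = trans (cong valueᶜ (lookupᶜ-correct t l)) (valueᶜ-correct (tapesOf l t))

opaque
  tagᵖ outputᵖ argumentᵖ indexᵖ inputᵖ : Prim 1
  tagᵖ = call (restate (ifzᵖ x₂ k (ifzᵖ (predᵖ x₂) (lit 0) k)) tagOf (λ { (u ∷ e ∷ f ∷ q ∷ l ∷ []) → refl })) fieldsᵖ
    where
    k : Prim 5
    k = kindᵖ (fetchᵖ x₁ x₃)
  outputᵖ = call (restate (ifzᵖ x₂ (operandᵖ (lit 0) x₄) (ifzᵖ (kindᵖ (fetchᵖ x₁ x₃)) (lit 0) (lit 1))) outputOf
    (λ { (u ∷ e ∷ f ∷ q ∷ l ∷ []) → refl })) fieldsᵖ
  argumentᵖ = call (restate (operandᵖ (π₁ᵖ (bodyᵖ (fetchᵖ x₁ x₃))) x₄) argumentOf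
    (λ { (u ∷ e ∷ f ∷ q ∷ l ∷ []) → refl })) fieldsᵖ
  indexᵖ = call (restate x₀ indexOf (λ { (u ∷ e ∷ f ∷ q ∷ l ∷ []) → refl })) fieldsᵖ
  inputᵖ = call (restate (pairᵖ x₀ (pairᵖ (operandᵖ (π₁ᵖ b) x₄) (operandᵖ (π₁ᵖ (π₂ᵖ b)) x₄))) inputOf
    (λ { (u ∷ e ∷ f ∷ q ∷ l ∷ []) → refl })) fieldsᵖ
    where
    b : Prim 5
    b = bodyᵖ (fetchᵖ x₁ x₃)

  nextᵖ : Prim 3
  nextᵖ = call (restate (call successorStateᵖ (x₀ ∷ x₁ ∷ x₂ ∷ x₃ ∷ x₄ ∷ x₅ ∷ x₆ ∷ []))
      (λ { (u ∷ e ∷ f ∷ q ∷ l ∷ o ∷ a ∷ []) → nextOf (u ∷ e ∷ f ∷ q ∷ l ∷ []) o a })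
      (λ { (u ∷ e ∷ f ∷ q ∷ l ∷ o ∷ a ∷ []) → refl }))
    (fieldsᵖ Vec.++ x₁ ∷ x₂ ∷ [])

tag out arg idx inp : ℕ → ℕ
tag R = fun tagᵖ (R ∷ [])
out R = fun outputᵖ (R ∷ [])
arg R = fun argumentᵖ (R ∷ [])
idx R = fun indexᵖ (R ∷ [])
inp R = fun inputᵖ (R ∷ [])

next : ℕ → ℕ → ℕ → ℕ
next R o a = fun nextᵖ (R ∷ o ∷ a ∷ [])

opaque
  unfolding tagᵖ

  tag-state : ∀ u e f q l → tag (encodeState u e f q l) ≡ limited f (kind (fetch e q))
  tag-state u e f q l = cong tagOf (fields-encodeState u e f q l)

  out-state : ∀ u e f q l → out (encodeState u e f q l) ≡ output f (kind (fetch e q)) (value (tapesOf l 0))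
  out-state u e f q l = trans (cong outputOf (fields-encodeState u e f q l))
    (cong (output f (kind (fetch e q))) (operand-correct 0 l))

  arg-state : ∀ u e f q l → arg (encodeState u e f q l) ≡ value (tapesOf l (π₁ (body (fetch e q))))
  arg-state u e f q l = trans (cong argumentOf (fields-encodeState u e f q l)) (operand-correct (π₁ (body (fetch e q))) l)

  idx-state : ∀ u e f q l → idx (encodeState u e f q l) ≡ u
  idx-state u e f q l = cong indexOf (fields-encodeState u e f q l)

  inp-state : ∀ u e f q l → inp (encodeState u e f q l) ≡ pair u (pair (value (tapesOf l (π₁ (body (fetch e q)))))
                                                         (value (tapesOf l (π₁ (π₂ (body (fetch e q)))))))
  inp-state u e f q l = trans (cong inputOf (fields-encodeState u e f q l))
    (cong₂ (λ x y → pair u (pair x y)) (operand-correct _ l) (operand-correct _ l))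

  next-state : ∀ u e f q l o a → next (encodeState u e f q l) o a ≡ successorState u e f q (encodeLog l) o a
  next-state u e f q l o a = cong (λ R → nextOf R o a) (fields-encodeState u e f q l)

opaque
  -- `N` selects the mode. For `N` = 0 the index, the simulated program, its input and the bound k
  -- all come from the input `x`, with fuel `suc k`; otherwise `pred N` supplies the index and the
  -- program, and `x` is the simulated input.
  initialᵖ : Prim 2
  initialᵖ = restate
    (ifzᵖ x₁ (call start (π₁ᵖ p ∷ π₁ᵖ (π₂ᵖ p) ∷ sucᵖ (π₂ᵖ x₀) ∷ π₂ᵖ (π₂ᵖ p) ∷ []))
           (call start (π₁ᵖ (predᵖ x₁) ∷ π₂ᵖ (predᵖ x₁) ∷ lit 0 ∷ x₀ ∷ [])))
    (λ { (x ∷ N ∷ []) → ifz N (startState (π₁ (π₁ x)) (π₁ (π₂ (π₁ x))) (suc (π₂ x)) (π₂ (π₂ (π₁ x))))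
                            (startState (π₁ (pred N)) (π₂ (pred N)) 0 x) })
    (λ { (x ∷ N ∷ []) → refl })
    where
    startState : ℕ → ℕ → ℕ → ℕ → ℕ
    startState u e f m = pair u (pair e (pair f (pair 0 (cons (pair 0 (unaryᶜ m)) 0))))
    start : Prim 4
    start = restate (pairᵖ x₀ (pairᵖ x₁ (pairᵖ x₂ (pairᵖ (lit 0) (consᵖ (pairᵖ (lit 0) (unaryᵖ x₃)) (lit 0))))))
      (λ { (u ∷ e ∷ f ∷ m ∷ []) → startState u e f m }) (λ { (u ∷ e ∷ f ∷ m ∷ []) → refl })
    p : Prim 2
    p = π₁ᵖ x₀

initialLog : ℕ → Log
initialLog m = (0 , unary m) ∷ []

opaque
  unfolding encodeState initialᵖ

  initial-bounded : ∀ u e m k → fun initialᵖ (pair (pair u (pair e m)) k ∷ 0 ∷ []) ≡ encodeState u e (suc k) 0 (initialLog m)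
  initial-bounded u e m k
    rewrite unpair-pair (pair u (pair e m)) k | unpair-pair u (pair e m) | unpair-pair e m | unaryᶜ-correct m = refl

  initial-unbounded : ∀ u e m → fun initialᵖ (m ∷ suc (pair u e) ∷ []) ≡ encodeState u e 0 0 (initialLog m)
  initial-unbounded u e m rewrite unpair-pair u e | unaryᶜ-correct m = refl

-- Matches the status of the simulated machine with the data computed by the interpreter; both
-- directions of the simulation proceed by cases on it. In `moves` the oracle value has to be the
-- true one, because the instruction may consult the oracle.
data Simulated (X : ℕ → ℕ) (u e f q : ℕ) (l : Log) : Set where
  halted : status (program e) X (config q (tapesOf l)) ≡ halted (value (tapesOf l 0)) →
           kind (fetch e q) ≡ 0 →
           Simulated X u e f q l
  moves  : ∀ {q′ l′} → status (program e) X (config q (tapesOf l)) ≡ moves (config q′ (tapesOf l′)) →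
           kind (fetch e q) ≡ 1 →
           (∀ a → next (encodeState u e f q l) (X (arg (encodeState u e f q l))) a ≡ encodeState u e (pred f) q′ l′) →
           Simulated X u e f q l
  asks   : ∀ {e′ m′ t q′} →
           status (program e) X (config q (tapesOf l)) ≡ asks e′ m′ (λ a → config q′ (tapesOf ((t , unary a) ∷ l))) →
           kind (fetch e q) ≡ 2 → inp (encodeState u e f q l) ≡ pair u (pair e′ m′) →
           (∀ o a → next (encodeState u e f q l) o a ≡ encodeState u e (pred f) q′ ((t , unary a) ∷ l)) →
           Simulated X u e f q l

opaque
  unfolding encodeState successorState

  successorState-update : ∀ u e f q l o a q′ t S → update (fetch e q) (encodeLog l) o a ≡ pair q′ (pair t (encodeTape S)) →
    successorState u e f q (encodeLog l) o a ≡ encodeState u e (pred f) q′ ((t , S) ∷ l)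
  successorState-update u e f q l o a q′ t S eq rewrite eq | unpair-pair q′ (pair t (encodeTape S)) = refl

actUpdate-correct : ∀ b l → let
    t = π₁ b
    α = choose (Tape.scanned (tapesOf l t)) (toAction (π₁ (π₂ b))) (toAction (π₂ (π₂ b)))
  in actUpdate b (encodeLog l) ≡ pair (Action.goto α)
       (pair t (encodeTape (shift (Action.move α) (record (tapesOf l t) { scanned = Action.write α }))))
actUpdate-correct b l = trans (cong (λ T → actBy (π₁ (π₂ T)) b T) (lookupᶜ-correct (π₁ b) l)) (go (tapesOf l (π₁ b)))
  where
  go : ∀ T → let α = choose (Tape.scanned T) (toAction (π₁ (π₂ b))) (toAction (π₂ (π₂ b))) in
    actBy (π₁ (π₂ (encodeTape T))) b (encodeTape T) ≡
    pair (Action.goto α) (pair (π₁ b) (encodeTape (shift (Action.move α) (record T { scanned = Action.write α }))))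
  go T@(tape ls a rs) = trans
    (cong (λ s → actBy s b (encodeTape T))
      (trans (cong π₁ (π₂-pair (encodeSymbols ls) (pair (encodeSymbol a) (encodeSymbols rs))))
        (π₁-pair (encodeSymbol a) (encodeSymbols rs))))
    (by-symbol a)
    where
    by-symbol : ∀ a′ → let α = choose a′ (toAction (π₁ (π₂ b))) (toAction (π₂ (π₂ b))) in
      actBy (encodeSymbol a′) b (encodeTape T) ≡
      pair (Action.goto α) (pair (π₁ b) (encodeTape (shift (Action.move α) (record T { scanned = Action.write α }))))
    by-symbol blank = cong (λ S → pair (π₂ (π₂ (π₁ (π₂ b)))) (pair (π₁ b) S)) (performᶜ-correct (π₁ (π₂ b)) T)
    by-symbol one   = cong (λ S → pair (π₂ (π₂ (π₂ (π₂ b)))) (pair (π₁ b) S)) (performᶜ-correct (π₂ (π₂ b)) T)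

simulate : ∀ X u e f q l → Simulated X u e f q l
simulate X u e f q l = go (fetch e q) refl
  where
  status-eq : ∀ c → fetch e q ≡ c → status (program e) X (config q (tapesOf l)) ≡ execute X (decodeInstruction c) (tapesOf l)
  status-eq c eq = cong (λ i → execute X i (tapesOf l))
    (trans (fetch-toProgram q e e ≤-refl) (cong decodeInstruction eq))

  module _ (c : ℕ) (eq : fetch e q ≡ suc c) {tag : ℕ} (tag≡ : π₁ (π₁ c) ≡ tag) where
    decoded : status (program e) X (config q (tapesOf l)) ≡ execute X (just (toInstruction′ tag (π₂ (π₁ c)))) (tapesOf l)
    decoded = trans (status-eq (suc c) eq) (cong (λ g → execute X (just (toInstruction′ g (π₂ (π₁ c)))) (tapesOf l)) tag≡)

    kind-eq : kind (fetch e q) ≡ ifz (pred tag) 1 2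
    kind-eq = trans (cong kind eq) (cong (λ g → ifz (pred g) 1 2) tag≡)

    next-eq : ∀ o a q′ t S → updateBy tag (π₂ (π₁ c)) (encodeLog l) o a ≡ pair q′ (pair t (encodeTape S)) →
      next (encodeState u e f q l) o a ≡ encodeState u e (pred f) q′ ((t , S) ∷ l)
    next-eq o a q′ t S U≡ = trans (next-state u e f q l o a) (successorState-update u e f q l o a q′ t S
      (trans (cong (λ d → update d (encodeLog l) o a) eq)
        (trans (cong (λ g → updateBy g (π₂ (π₁ c)) (encodeLog l) o a) tag≡) U≡)))

  instruction : ∀ c → fetch e q ≡ suc c → ∀ tag → π₁ (π₁ c) ≡ tag → Simulated X u e f q l
  instruction c eq 0 tag≡ = moves (decoded c eq tag≡) (kind-eq c eq tag≡)
    (λ a → next-eq c eq tag≡ _ a (Action.goto α) (π₁ b)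
      (shift (Action.move α) (record (tapesOf l (π₁ b)) { scanned = Action.write α })) (actUpdate-correct b l))
    where
    b = π₂ (π₁ c)
    α = choose (Tape.scanned (tapesOf l (π₁ b))) (toAction (π₁ (π₂ b))) (toAction (π₂ (π₂ b)))
  instruction c eq 1 tag≡ = moves (decoded c eq tag≡) (kind-eq c eq tag≡)
    (λ a → next-eq c eq tag≡ _ a (π₂ (π₂ b)) (π₁ (π₂ b)) (unary (X (value (tapesOf l (π₁ b)))))
      (cong (λ S → pair (π₂ (π₂ b)) (pair (π₁ (π₂ b)) S))
        (trans (cong (λ v → unaryᶜ (X v))
            (trans (arg-state u e f q l) (cong (λ d → value (tapesOf l (π₁ (body d)))) eq)))
          (unaryᶜ-correct (X (value (tapesOf l (π₁ b))))))))
    where b = π₂ (π₁ c)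
  instruction c eq (suc (suc g)) tag≡ = asks (decoded c eq tag≡) (kind-eq c eq tag≡)
    (trans (inp-state u e f q l)
      (cong (λ d → pair u (pair (value (tapesOf l (π₁ (body d)))) (value (tapesOf l (π₁ (π₂ (body d))))))) eq))
    (λ o a → next-eq c eq tag≡ o a (π₂ (π₂ (π₂ b))) (π₁ (π₂ (π₂ b))) (unary a)
      (cong (λ S → pair (π₂ (π₂ (π₂ b))) (pair (π₁ (π₂ (π₂ b))) S)) (unaryᶜ-correct a)))
    where b = π₂ (π₁ c)

  go : ∀ c → fetch e q ≡ c → Simulated X u e f q l
  go zero    eq = halted (status-eq 0 eq) (cong kind eq)
  go (suc c) eq = instruction c eq (π₁ (π₁ c)) refl

-- Least fixed points

-- The derivations of answers lie inside finite paths and inside infinite runs given as functions;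
-- treating steps and paths by mutual recursion makes the induction structural.
I-fold : ∀ {C} → (∀ {e m X o} → I C e m X o → C e m X o) → ∀ {e m X o} → I∞ e m X o → C e m X o
I-fold {C} alg = go
  where
  mutual
    go : ∀ {e m X o} → I∞ e m X o → C e m X o
    go (fold (halts (c , p , eq)))    = alg (halts (c , go-star p , eq))
    go (fold (runs (r , start , p))) = alg (runs (r , start , λ i → go-step (p i)))

    go-step : ∀ {P X c d} → Step P X (I-Answers I∞ X) c d → Step P X (I-Answers C X) c d
    go-step (compute eq)              = compute eq
    go-step (answer eq (o , i , a≡)) = answer eq (o , go i , a≡)

    go-star : ∀ {P X c d} → Star (Step P X (I-Answers I∞ X)) c d → Star (Step P X (I-Answers C X)) c d
    go-star ε       = ε
    go-star (s ◅ p) = go-step s ◅ go-star p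

Γ-fold : ∀ {C} → (∀ {e m X n} → Γ C e m X n → C e m X n) → ∀ {e m X n} → Γ∞ e m X n → C e m X n
Γ-fold {C} alg = go
  where
  mutual
    go : ∀ {e m X n} → Γ∞ e m X n → C e m X n
    go (fold (c , p , eq)) = alg (c , go-star p , eq)

    go-star : ∀ {P X c d} → Star (Step P X (E-Answers Γ∞ X)) c d → Star (Step P X (E-Answers C X)) c d
    go-star ε                                 = ε
    go-star (compute eq ◅ p)                  = compute eq ◅ go-star p
    go-star (answer eq (y , h , E-y) ◅ p) = answer eq (y , (λ k → go (h k)) , E-y) ◅ go-star p

-- Single-valuedness of feedback computation

halted-no-step : ∀ {P X A c d v} → status P X c ≡ halted v → Step P X A c d → ⊥
halted-no-step eq (compute eq′)  with () ← trans (sym eq) eq′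
halted-no-step eq (answer eq′ _) with () ← trans (sym eq) eq′

module _ {P : Program} {X : ℕ → ℕ} {A B : Answers} (unique : ∀ {e m a b} → A e m a → B e m b → a ≡ b) where

  -- Two answer relations occur since, inside the induction below, one run has induction hypotheses
  -- as its answers and the other has derivations.
  step-unique : ∀ {c d d′} → Step P X A c d → Step P X B c d′ → d ≡ d′
  step-unique (compute eq) (compute eq′) with refl ← trans (sym eq) eq′ = refl
  step-unique (compute eq) (answer eq′ _) with () ← trans (sym eq) eq′
  step-unique (answer eq _) (compute eq′) with () ← trans (sym eq) eq′
  step-unique (answer eq α) (answer eq′ β) with refl ← trans (sym eq) eq′ with refl ← unique α β = refl

  halts-unique : ∀ {c d d′ v v′} → Star (Step P X A) c d → status P X d ≡ halted v →
    Star (Step P X B) c d′ → status P X d′ ≡ halted v′ → v ≡ v′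
  halts-unique ε eq ε eq′ with refl ← trans (sym eq) eq′ = refl
  halts-unique ε eq (s ◅ _) _ = ⊥-elim (halted-no-step eq s)
  halts-unique (s ◅ _) _ ε eq = ⊥-elim (halted-no-step eq s)
  halts-unique (s ◅ p) eq (s′ ◅ q) eq′ with refl ← step-unique s s′ = halts-unique p eq q eq′

  halts-not-runs : ∀ {c d v} → Star (Step P X A) c d → status P X d ≡ halted v →
    (r : ℕ → Config) → (∀ i → Step P X B (r i) (r (suc i))) → ∀ i → r i ≡ c → ⊥
  halts-not-runs ε eq r p i refl = halted-no-step eq (p i)
  halts-not-runs (s ◅ q) eq r p i refl = halts-not-runs q eq r p (suc i) (sym (step-unique s (p i)))

-- Induction on the first derivation against an arbitrary second one: as the answers agree, both
-- runs take the same steps, and a run that halts cannot go on forever.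
I-unique : ∀ {e m X o o′} → I∞ e m X o → I∞ e m X o′ → o ≡ o′
I-unique i j = I-fold {λ e m X o → ∀ {o′} → I∞ e m X o′ → o ≡ o′} unique i j
  where
  unique-answers : ∀ {X e m a b} →
    I-Answers (λ e m X o → ∀ {o′} → I∞ e m X o′ → o ≡ o′) X e m a → I-Answers I∞ X e m b → a ≡ b
  unique-answers (o , u , a≡) (o′ , i , b≡) = trans a≡ (trans (cong (λ o → signalCode (signal o)) (u i)) (sym b≡))

  unique : ∀ {e m X o} → I (λ e m X o → ∀ {o′} → I∞ e m X o′ → o ≡ o′) e m X o → ∀ {o′} → I∞ e m X o′ → o ≡ o′
  unique (halts (_ , p , eq)) (fold (halts (_ , q , eq′))) = cong ⟨↓,_⟩ (halts-unique unique-answers p eq q eq′)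
  unique (halts (_ , p , eq)) (fold (runs (r , r≡ , q))) = ⊥-elim (halts-not-runs unique-answers p eq r q 0 r≡)
  unique (runs (r , r≡ , q)) (fold (halts (_ , p , eq))) =
    ⊥-elim (halts-not-runs (λ α β → sym (unique-answers β α)) p eq r q 0 r≡)
  unique (runs _) (fold (runs _)) = refl

-- Runs of a given length

data Path (P : Program) (X : ℕ → ℕ) (A : Answers) : ℕ → Config → Config → Set where
  []  : ∀ {c} → Path P X A 0 c c
  _∷_ : ∀ {k c d d′} → Step P X A c d → Path P X A k d d′ → Path P X A (suc k) c d′

path-last : ∀ {P X A k c d} → Path P X A (suc k) c d → ∃[ c′ ] (Path P X A k c c′ × Step P X A c′ d)
path-last (s ∷ [])      = _ , [] , s
path-last (s ∷ p@(_ ∷ _)) = let _ , q , t = path-last p in _ , s ∷ q , t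

path-unique : ∀ {P X A} → (∀ {e m a b} → A e m a → A e m b → a ≡ b) →
  ∀ {k c d d′} → Path P X A k c d → Path P X A k c d′ → d ≡ d′
path-unique unique []      []        = refl
path-unique unique (s ∷ p) (s′ ∷ q) with refl ← step-unique unique s s′ = path-unique unique p q

-- The steps of the interpreter

open Machine initialᵖ argumentᵖ tagᵖ outputᵖ indexᵖ inputᵖ nextᵖ using (M; machine; machineᵖ; sound; complete)

module Interpretation (X : ℕ → ℕ) (u e : ℕ) where

  conf : ℕ → Log → Config
  conf q l = config q (tapesOf l)

  limited-suc : ∀ f {k t} → limited f k ≡ suc t → k ≡ suc t
  limited-suc zero          eq = eq
  limited-suc (suc (suc f)) eq = eq

  -- The answer relations are left open, so that the simulation applies both within the induction,
  -- where answers are hypotheses, and to actual computations.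
  module FromFeedback {A B : Answers} (convert : ∀ e′ m′ {a} → A e′ m′ a → B u (pair u (pair e′ m′)) a) where

    step-running : ∀ {q l c′} → Step (program e) X A (conf q l) c′ → ∃[ t ] kind (fetch e q) ≡ suc t
    step-running {q} {l} s with simulate X u e 0 q l
    ... | moves _ k≡ _  = _ , k≡
    ... | asks _ k≡ _ _ = _ , k≡
    ... | halted eq _   = ⊥-elim (halted-no-step eq s)

    transition : ∀ {f q l c′} → (∀ k → limited f k ≡ k) → Step (program e) X A (conf q l) c′ →
      ∃[ q′ ] ∃[ l′ ] (c′ ≡ conf q′ l′ × Transition M X B (encodeState u e f q l) (encodeState u e (pred f) q′ l′))
    transition {f} {q} {l} unlimited s with simulate X u e f q l
    ... | halted eq _ = ⊥-elim (halted-no-step eq s)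
    transition {f} {q} {l} unlimited (compute eq′) | moves eq k≡ next≡ with refl ← trans (sym eq) eq′ =
      _ , _ , refl , subst (Transition M X B _) (next≡ 0)
        (move (trans (tag-state u e f q l) (trans (unlimited _) k≡)))
    transition {f} {q} {l} unlimited (answer eq′ _) | moves eq _ _ with () ← trans (sym eq) eq′
    transition {f} {q} {l} unlimited (compute eq′) | asks eq _ _ _ with () ← trans (sym eq) eq′
    transition {f} {q} {l} unlimited (answer eq′ α) | asks eq k≡ inp≡ next≡ with refl ← trans (sym eq) eq′ =
      _ , _ , refl , subst (Transition M X B _) (next≡ _ _)
        (ask (trans (tag-state u e f q l) (trans (unlimited _) k≡))
          (subst₂ (λ i p → B i p _) (sym (idx-state u e f q l)) (sym inp≡) (convert _ _ α)))

    halted-output : ∀ {f q l v} → status (program e) X (conf q l) ≡ halted v →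
      tag (encodeState u e f q l) ≡ 0 × out (encodeState u e f q l) ≡ output f 0 v
    halted-output {f} {q} {l} eq′ with simulate X u e f q l
    ... | moves eq _ _ with () ← trans (sym eq) eq′
    ... | asks eq _ _ _ with () ← trans (sym eq) eq′
    ... | halted eq k≡ with refl ← trans (sym eq) eq′ =
      trans (tag-state u e f q l) (trans (cong (limited f) k≡) (limited-0 f)) ,
      trans (out-state u e f q l) (cong (λ k → output f k (value (tapesOf l 0))) k≡)
      where
      limited-0 : ∀ f → limited f 0 ≡ 0
      limited-0 zero          = refl
      limited-0 (suc zero)    = refl
      limited-0 (suc (suc f)) = refl

    exhausted-output : ∀ {q l c′} → Step (program e) X A (conf q l) c′ → Output M X B (encodeState u e 1 q l) 1
    exhausted-output {q} {l} s = let t , k≡ = step-running {q} {l} s in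
      _ , ε , tag-state u e 1 q l , trans (out-state u e 1 q l) (cong (λ k → output 1 k (value (tapesOf l 0))) k≡)

    unbounded-output : ∀ {q l d v} → Star (Step (program e) X A) (conf q l) d → status (program e) X d ≡ halted v →
      Output M X B (encodeState u e 0 q l) v
    unbounded-output {q} {l} ε eq = let t , o = halted-output {0} {q} {l} eq in _ , ε , t , o
    unbounded-output {q} {l} (s ◅ p) eq with _ , _ , refl , t ← transition {0} {q} {l} (λ _ → refl) s =
      let R , p , done = unbounded-output p eq in R , t ◅ p , done

    -- The value of the universal program with bound k on a run that halts after n steps: 0 if n ≤
    -- k, and 1 otherwise.
    clock : ℕ → ℕ → ℕ
    clock zero    _       = 0
    clock (suc n) zero    = 1
    clock (suc n) (suc k) = clock n k

    clock-stops : ∀ n → clock n n ≡ 0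
    clock-stops zero    = refl
    clock-stops (suc n) = clock-stops n

    bounded-output : ∀ {n q l v} → Halting (program e) X A v n (conf q l) → ∀ k →
      Output M X B (encodeState u e (suc k) q l) (clock n k)
    bounded-output {q = q} {l} (stop eq) k = let t , o = halted-output {suc k} {q} {l} eq in _ , ε , t , o
    bounded-output {q = q} {l} (step s h) zero = exhausted-output {q} {l} s
    bounded-output {q = q} {l} (step s h) (suc k) with _ , _ , refl , t ← transition {suc (suc k)} {q} {l} (λ _ → refl) s =
      let R , p , done = bounded-output h k in R , t ◅ p , done

    running-output : (r : ℕ → Config) → (∀ i → Step (program e) X A (r i) (r (suc i))) →
      ∀ k i {q l} → r i ≡ conf q l → Output M X B (encodeState u e (suc k) q l) 1
    running-output r p zero i {q} {l} r≡ = exhausted-output {q} {l} (subst (λ c → Step (program e) X A c (r (suc i))) r≡ (p i))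
    running-output r p (suc k) i {q} {l} r≡
      with _ , _ , r≡′ , t ← transition {suc (suc k)} {q} {l} (λ _ → refl)
             (subst (λ c → Step (program e) X A c (r (suc i))) r≡ (p i)) =
      let R , p , done = running-output r p k (suc i) r≡′ in R , t ◅ p , done

  module ToFeedback {A B : Answers} (convert : ∀ e′ m′ {a} → B u (pair u (pair e′ m′)) a → A e′ m′ a) where

    untransition : ∀ {f q l R′} → Transition M X B (encodeState u e f q l) R′ →
      ∃[ q′ ] ∃[ l′ ] (R′ ≡ encodeState u e (pred f) q′ l′ × Step (program e) X A (conf q l) (conf q′ l′))
    untransition {f} {q} {l} t with simulate X u e f q l
    untransition {f} {q} {l} (move tag≡) | halted _ k≡
      with () ← trans (sym (limited-suc f (trans (sym (tag-state u e f q l)) tag≡))) k≡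
    untransition {f} {q} {l} (ask tag≡ _) | halted _ k≡
      with () ← trans (sym (limited-suc f (trans (sym (tag-state u e f q l)) tag≡))) k≡
    untransition {f} {q} {l} (move tag≡) | moves eq _ next≡ = _ , _ , next≡ 0 , compute eq
    untransition {f} {q} {l} (ask tag≡ _) | moves _ k≡ _
      with () ← trans (sym (limited-suc f (trans (sym (tag-state u e f q l)) tag≡))) k≡
    untransition {f} {q} {l} (move tag≡) | asks _ k≡ _ _
      with () ← trans (sym (limited-suc f (trans (sym (tag-state u e f q l)) tag≡))) k≡
    untransition {f} {q} {l} (ask tag≡ α) | asks eq _ inp≡ next≡ =
      _ , _ , next≡ _ _ , answer eq (convert _ _ (subst₂ (λ i p → B i p _) (idx-state u e f q l) inp≡ α))

    unbounded-run : ∀ {R R′ q l} → R ≡ encodeState u e 0 q l → Star (Transition M X B) R R′ → tag R′ ≡ 0 →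
      ∃[ d ] (Star (Step (program e) X A) (conf q l) d × status (program e) X d ≡ halted (out R′))
    unbounded-run {q = q} {l} refl ε tag≡ with simulate X u e 0 q l
    ... | halted eq k≡ = _ , ε , trans eq (cong halted (sym (out-state u e 0 q l)))
    ... | moves _ k≡ _ with () ← trans (sym k≡) (trans (sym (tag-state u e 0 q l)) tag≡)
    ... | asks _ k≡ _ _ with () ← trans (sym k≡) (trans (sym (tag-state u e 0 q l)) tag≡)
    unbounded-run {q = q} {l} refl (t ◅ p) tag≡ with _ , _ , R≡ , s ← untransition {0} {q} {l} t =
      let d , q , eq = unbounded-run R≡ p tag≡ in d , s ◅ q , eq

    Bounded : ℕ → Config → ℕ → Set
    Bounded k c v = (v ≡ 0 × ∃[ d ] ∃[ w ] (Star (Step (program e) X A) c d × status (program e) X d ≡ halted w))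
                  ⊎ (v ≡ 1 × ∃[ d ] Path (program e) X A k c d)

    -- Tag 0 in a state whose simulated machine still runs means that the fuel is spent, which
    -- leaves only `k` = 0 and the empty path.
    exhausted : ∀ k {q l t v} → kind (fetch e q) ≡ suc t → tag (encodeState u e (suc k) q l) ≡ 0 →
      out (encodeState u e (suc k) q l) ≡ v → v ≡ 1 × ∃[ d ] Path (program e) X A k (conf q l) d
    exhausted zero {q} {l} k≡ _ out≡ =
      trans (sym out≡) (trans (out-state u e 1 q l) (cong (λ k → output 1 k (value (tapesOf l 0))) k≡)) , _ , []
    exhausted (suc k) {q} {l} k≡ tag≡ _ with () ← trans (sym k≡) (trans (sym (tag-state u e (2 + k) q l)) tag≡)

    bounded-run : ∀ {R q l v} k → R ≡ encodeState u e (suc k) q l → Output M X B R v → Bounded k (conf q l) v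
    bounded-run {q = q} {l} k refl (_ , ε , tag≡ , out≡) with simulate X u e (suc k) q l
    ... | halted eq k≡  = inj₁ (trans (sym out≡) (trans (out-state u e (suc k) q l)
      (cong (λ j → output (suc k) j (value (tapesOf l 0))) k≡)) , _ , _ , ε , eq)
    ... | moves _ k≡ _  = inj₂ (exhausted k k≡ tag≡ out≡)
    ... | asks _ k≡ _ _ = inj₂ (exhausted k k≡ tag≡ out≡)
    bounded-run {q = q} {l} zero refl (_ , t ◅ p , done) with t
    ... | move tag≡ with () ← trans (sym (tag-state u e 1 q l)) tag≡
    ... | ask tag≡ _ with () ← trans (sym (tag-state u e 1 q l)) tag≡
    bounded-run {q = q} {l} (suc k) refl (_ , t ◅ p , done)
      with _ , _ , R≡ , s ← untransition {suc (suc k)} {q} {l} t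
      with bounded-run k R≡ (_ , p , done)
    ... | inj₁ (v≡ , d , w , p′ , eq) = inj₁ (v≡ , d , w , s ◅ p′ , eq)
    ... | inj₂ (v≡ , d , p′)          = inj₂ (v≡ , d , s ∷ p′)

-- The universal program and the function k₁

codeOf : ℕ → ℕ
codeOf N = fun machineᵖ (N ∷ [])

program-codeOf : ∀ N → program (codeOf N) ≡ machine N
program-codeOf N = program-encode (machine N)

opaque
  u : ℕ
  u = codeOf 0

  program-u : program u ≡ machine 0
  program-u = program-codeOf 0

k₁ : ℕ → ℕ
k₁ e = codeOf (suc (pair u e))

k₁-primitive-recursive : PrimitiveRecursive k₁
k₁-primitive-recursive = term p , λ x → correct p (x ∷ [])
  where
  p : Prim 1
  p = call machineᵖ (sucᵖ (pairᵖ (constᵖ u) x₀) ∷ [])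

machine-halts : ∀ {i N X A x v} → program i ≡ machine N →
  Output M X A (fun initialᵖ (x ∷ N ∷ [])) v → HaltsWith (program i) X A x v
machine-halts {i} {N} {X} {A} {x} {v} eq h = subst (λ P → HaltsWith P X A x v) (sym eq) (complete x N h)

machine-output : ∀ {i N X A x v} → program i ≡ machine N →
  HaltsWith (program i) X A x v → Output M X A (fun initialᵖ (x ∷ N ∷ [])) v
machine-output {i} {N} {X} {A} {x} {v} eq h = sound x N (subst (λ P → HaltsWith P X A x v) eq h)

-- The values 0 and 1 of `E` are already the codes of ↓ and ↑, so the answer reaches the simulated
-- machine untranslated.
Queried : ℕ → ℕ → (ℕ → ℕ) → Outcome → Set
Queried e m X o = E-Answers Γ∞ X u (pair u (pair e m)) (signalCode (signal o))

convert-I : ∀ {X} e′ m′ {a} → I-Answers Queried X e′ m′ a → E-Answers Γ∞ X u (pair u (pair e′ m′)) a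
convert-I _ _ (o , h , refl) = h

queried : ∀ {e m X o} → I∞ e m X o → Queried e m X o
queried = I-fold {Queried} answered
  where
  answered : ∀ {e m X o} → I Queried e m X o → Queried e m X o
  answered {e} {m} {X} (halts (_ , p , eq)) =
    let n , h = halting p eq in
    clock n ,
    (λ k → fold (machine-halts program-u
      (subst (λ R → Output M X _ R (clock n k)) (sym (initial-bounded u e m k)) (bounded-output h k)))) ,
    some-zero (n , clock-stops n)
    where open Interpretation.FromFeedback X u e {I-Answers Queried X} {E-Answers Γ∞ X} convert-I
  answered {e} {m} {X} (runs (r , r≡ , p)) =
    (λ _ → 1) ,
    (λ k → fold (machine-halts program-u
      (subst (λ R → Output M X _ R 1) (sym (initial-bounded u e m k)) (running-output r p k 0 r≡)))) ,
    no-zero (λ _ ())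
    where open Interpretation.FromFeedback X u e {I-Answers Queried X} {E-Answers Γ∞ X} convert-I

feedback⇒E : ∀ {e m X v} → I∞ e m X ⟨↓, v ⟩ → Γ∞ (k₁ e) m X v
feedback⇒E {e} {m} {X} (fold (halts (_ , p , eq))) = fold (machine-halts (program-codeOf (suc (pair u e)))
  (subst (λ R → Output M X _ R _) (sym (initial-unbounded u e m)) (unbounded-output p eq)))
  where
  convert : ∀ e′ m′ {a} → I-Answers I∞ X e′ m′ a → E-Answers Γ∞ X u (pair u (pair e′ m′)) a
  convert e′ m′ (o , i , a≡) = convert-I e′ m′ (o , queried i , a≡)

  open Interpretation.FromFeedback X u e {I-Answers I∞ X} {E-Answers Γ∞ X} convert

-- The induction ranges over all indices and inputs; the two equations make the claim vacuous for
-- computations other than bounded simulations by `u`.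
Simulating : ℕ → ℕ → (ℕ → ℕ) → ℕ → Set
Simulating i x X v = ∀ e m k → i ≡ u → x ≡ pair (pair u (pair e m)) k →
  (v ≡ 0 × ∃[ w ] HaltsWith (program e) X (I-Answers I∞ X) m w)
  ⊎ (v ≡ 1 × ∃[ d ] Path (program e) X (I-Answers I∞ X) k (initial m) d)

-- Which case holds is told by the derivation of `E y a`. A zero of `y` yields a halting run; if
-- there is none, there are runs of every length, each obtained from its own bound.
convert-E : ∀ {X} e m {a} → E-Answers Simulating X u (pair u (pair e m)) a → I-Answers I∞ X e m a
convert-E {X} e m (y , h , some-zero (n , y≡0)) with h n e m n refl refl
... | inj₁ (_ , w , H)   = ⟨↓, w ⟩ , fold (halts H) , refl
... | inj₂ (y≡1 , _) with () ← trans (sym y≡0) y≡1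
convert-E {X} e m (y , h , no-zero y≢0) = ⟨↑,ω⟩ , fold (runs (r , r-0 , r-step)) , refl
  where
  path : ∀ n → ∃[ d ] Path (program e) X (I-Answers I∞ X) n (initial m) d
  path n with h n e m n refl refl
  ... | inj₁ (y≡0 , _) = ⊥-elim (y≢0 n y≡0)
  ... | inj₂ (_ , p)   = p

  unique : ∀ {e m a b} → I-Answers I∞ X e m a → I-Answers I∞ X e m b → a ≡ b
  unique (_ , i , a≡) (_ , j , b≡) = trans a≡ (trans (cong (λ o → signalCode (signal o)) (I-unique i j)) (sym b≡))

  r : ℕ → Config
  r n = proj₁ (path n)

  r-0 : r 0 ≡ initial m
  r-0 = path-unique unique (proj₂ (path 0)) []

  r-step : ∀ i → Step (program e) X (I-Answers I∞ X) (r i) (r (suc i))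
  -- Without its last step, the run of length `suc i` is a run of length `i`, and by uniqueness it
  -- ends in `r i`.
  r-step i = let _ , p , s = path-last (proj₂ (path (suc i))) in
    subst (λ c → Step (program e) X (I-Answers I∞ X) c (r (suc i))) (path-unique unique p (proj₂ (path i))) s

simulating : ∀ {i x X v} → Γ∞ i x X v → Simulating i x X v
simulating = Γ-fold {Simulating} λ { {X = X} h e m k refl refl → regroup (Interpretation.ToFeedback.bounded-run X u e
    {I-Answers I∞ X} {E-Answers Simulating X} convert-E k (initial-bounded u e m k) (machine-output program-u h)) }
  where
  regroup : ∀ {e m k X v} →
    Interpretation.ToFeedback.Bounded X u e {I-Answers I∞ X} {E-Answers Simulating X} convert-E k (initial m) v →
    (v ≡ 0 × ∃[ w ] HaltsWith (program e) X (I-Answers I∞ X) m w)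
    ⊎ (v ≡ 1 × ∃[ d ] Path (program e) X (I-Answers I∞ X) k (initial m) d)
  regroup (inj₁ (v≡ , d , w , p , eq)) = inj₁ (v≡ , w , d , p , eq)
  regroup (inj₂ p)                     = inj₂ p

E⇒feedback : ∀ {e m X v} → Γ∞ (k₁ e) m X v → I∞ e m X ⟨↓, v ⟩
E⇒feedback {e} {m} {X} {v} (fold h) = from-output (machine-output (program-codeOf (suc (pair u e))) h)
  where
  convert : ∀ e′ m′ {a} → E-Answers Γ∞ X u (pair u (pair e′ m′)) a → I-Answers I∞ X e′ m′ a
  convert e′ m′ (y , h , E-y) = convert-E e′ m′ (y , (λ k → simulating (h k)) , E-y)

  open Interpretation.ToFeedback X u e {I-Answers I∞ X} {E-Answers Γ∞ X} convert

  from-output : Output M X (E-Answers Γ∞ X) (fun initialᵖ (m ∷ suc (pair u e) ∷ [])) v → I∞ e m X ⟨↓, v ⟩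
  from-output (_ , p , tag≡ , refl) = fold (halts (unbounded-run (initial-unbounded u e m) p tag≡))

theorem1p2 : ∃[ k₁ ] (PrimitiveRecursive k₁ ×
    (∀ (e m : ℕ) (X : ℕ → ℕ) → ⟨ e ⟩^ X [ m ] ≃ ❴ k₁ e ❵ᴱ[ m , X ]))
theorem1p2 = k₁ , k₁-primitive-recursive , λ e m X →
  -- Agreement of the values is checked on the feedback side, where values are known to be unique.
  mk⇔ (λ (v , h) → v , feedback⇒E h) (λ (v , h) → v , E⇒feedback h) , λ {a} p q → agree (I-unique p (E⇒feedback q))
  where
  agree : ∀ {a b} → ⟨↓, a ⟩ ≡ ⟨↓, b ⟩ → a ≡ b
  agree refl = refl
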